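{- Let $d\geqslant 1$ be an integer and let $T_1,\dots,T_d$ be rooted trees of height $\omega$, without isolated branches, in which every node has at least one but at most countably many immediate successors. Let $A$ be a finite set with the discrete topology and let $f:\bigcup_{l\in\omega}\bigl(T_1(l)\times\cdots\times T_d(l)\bigr)\to A$ be a function. Let $F_0$ be an $F_\sigma$ filter over $\omega$, and for each $i\in\{1,\dots,d\}$ let $M_i$ be a subset of $[T_i]$ of the first category in $[T_i]$. Then there exist sets $D_1,\dots,D_d$, with $D_i$ dense in $[T_i]$ for each $i$, and an $F_\sigma$ filter $F\supseteq F_0$ over $\omega$, such that $D_i\cap M_i=\emptyset$ for each $i$, and such that the rule $$g(b_1,\dots,b_d)=a\quad\Leftrightarrow\quad\{n\in\omega\,|\,f(b_1(n),\dots,b_d(n))=a\}\in F$$ (for $b_1\in D_1,\dots,b_d\in D_d$, $a\in A$) defines a mapping $g:D_1\times\cdots\times D_d\to A$ (that is, for every $\langle b_1,\dots,b_d\rangle\in D_1\times\cdots\times D_d$ there is exactly one such $a\in A$), and this mapping $g$ is continuous. If $F_0$ is a countably generated filter, then $F$ can be chosen to be countably generated. Moreover, $F$ can be chosen to be a filter generated by $F_0\cup S$ for some countable set $S$ (of subsets of $\omega$).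
   Context: For a rooted tree $T$ of height $\omega$ (every node is at a finite height), $T(l)$ denotes the set of nodes at height $l$. $[T]$ denotes the set of all (infinite) branches of $T$, and for a branch $b\in[T]$ and $n\in\omega$, $b(n)$ denotes the node of $b$ at height $n$. The set $[T]$ carries the usual tree topology, whose basic open sets are the sets of all branches passing through a given node. A tree has no isolated branches if $[T]$ has no isolated points in this topology. The set $D_1\times\cdots\times D_d$ carries the subspace topology from the product $[T_1]\times\cdots\times[T_d]$. Filters over $\omega$ are proper filters of subsets of $\omega$. The power set $\mathcal P(\omega)$ is identified with ${}^\omega 2$ via characteristic functions and given the product topology. An $F_\sigma$ filter is a filter over $\omega$ which is a countable union of closed subsets of $\mathcal P(\omega)$. A filter is countably generated if it is generated, as a filter, by a countable family of subsets of $\omega$. -}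

module Defs where

open import Data.Bool using (Bool; true; false; _∧_)
open import Data.Fin using (Fin)
import Data.Fin.Properties as Fin
open import Data.List using (List; foldr)
open import Data.List.Relation.Unary.All using (All)
open import Data.Nat using (ℕ; suc; _<_)
open import Data.Product using (Σ; ∃; _×_; _,_; proj₁)
open import Function using (_∘_; const; _↔_)
open import Function.Properties.Inverse using (Inverse⇒Injection)
open import Level using (0ℓ)
open import Relation.Binary using (Rel; DecidableEquality)
open import Relation.Binary.PropositionalEquality using (_≡_; _≗_)
open import Relation.Nullary using (¬_; does)
open import Relation.Nullary.Decidable using (via-injection)
open import Relation.Unary using (Pred; _∈_; _⊆_; _≐_; _∩_; ∁; Empty; Satisfiable; ⋃)

-- A subset P of X is countable if it injects into ℕ; _≈_ is the equality of X.
Countable : {X : Set} → Rel X 0ℓ → Pred X 0ℓ → Set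
Countable {X} _≈_ P =
  ∃ λ (code : X → ℕ) → ∀ {x y} → x ∈ P → y ∈ P → code x ≡ code y → x ≈ y

finite⇒≟ : {A : Set} {k : ℕ} → A ↔ Fin k → DecidableEquality A
finite⇒≟ A↔Fin = via-injection (Inverse⇒Injection A↔Fin) Fin._≟_

-- A topology on X, presented by a base.

record Topology (X : Set) : Set₁ where
  field
    Index : Set
    Basic : Index → Pred X 0ℓ

module _ {X : Set} (𝒯 : Topology X) where
  open Topology 𝒯

  Open : Pred X 0ℓ → Set
  Open U = ∀ x → x ∈ U → ∃ λ i → x ∈ Basic i × Basic i ⊆ U

  Closed : Pred X 0ℓ → Set
  Closed C = Open (∁ C)

  Closure : Pred X 0ℓ → Pred X 0ℓ
  Closure P x = ∀ i → x ∈ Basic i → Satisfiable (Basic i ∩ P)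

  Dense : Pred X 0ℓ → Set₁
  Dense D = ∀ U → Open U → Satisfiable U → Satisfiable (U ∩ D)

  NowhereDense : Pred X 0ℓ → Set₁
  NowhereDense N = ∀ U → Open U → U ⊆ Closure N → Empty U

  FirstCategory : Pred X 0ℓ → Set₁
  FirstCategory M =
    ∃ λ (N : ℕ → Pred X 0ℓ) → (∀ k → NowhereDense (N k)) × M ≐ ⋃ ℕ N

  Fσ : Pred X 0ℓ → Set₁
  Fσ P = ∃ λ (C : ℕ → Pred X 0ℓ) → (∀ k → Closed (C k)) × P ≐ ⋃ ℕ C

Continuous : {X Y : Set} → Topology X → Topology Y → (X → Y) → Set₁
Continuous 𝒯 𝒰 g = ∀ V → Open 𝒰 V → Open 𝒯 (V ∘ g)

discrete : (A : Set) → Topology A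
discrete A = record { Index = A ; Basic = _≡_ }

-- All boxes of basic sets form a base because the product is finite.
product : {d : ℕ} {X : Fin d → Set} → (∀ i → Topology (X i)) → Topology (∀ i → X i)
product 𝒯 = record
  { Index = ∀ i → Topology.Index (𝒯 i)
  ; Basic = λ j x → ∀ i → x i ∈ Topology.Basic (𝒯 i) (j i)
  }

subspace : {X : Set} → Topology X → (P : Pred X 0ℓ) → Topology (Σ X P)
subspace 𝒯 P = record
  { Index = Topology.Index 𝒯
  ; Basic = λ i → Topology.Basic 𝒯 i ∘ proj₁
  }

-- A rooted tree all of whose nodes have finite height, graded by height:
-- Level l is T(l), and parent sends a node to its immediate predecessor.

record Tree : Set₁ where
  field
    Level       : ℕ → Set
    root        : Level 0
    root-unique : ∀ t → t ≡ root
    parent      : ∀ {l} → Level (suc l) → Level l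

  Successor : ∀ {l} → Level l → Pred (Level (suc l)) 0ℓ
  Successor t s = parent s ≡ t

open Tree public using (Level)

record Branch (T : Tree) : Set where
  open Tree T using (parent)
  field
    node     : ∀ n → Level T n
    coherent : ∀ n → parent (node (suc n)) ≡ node n

open Branch public using (node)

module _ {T : Tree} where
  infix 4 _≈ᵇ_

  -- Equality of branches; propositional equality of the underlying functions
  -- would be too fine without function extensionality.
  _≈ᵇ_ : Rel (Branch T) 0ℓ
  b ≈ᵇ c = ∀ n → node b n ≡ node c n

branches : (T : Tree) → Topology (Branch T)
branches T = record
  { Index = ∃ (Level T)
  ; Basic = λ (l , t) b → node b l ≡ t
  }

NoIsolatedBranches : Tree → Set
NoIsolatedBranches T = ∀ b → ¬ Open (branches T) (_≈ᵇ b)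

HasSuccessors : Tree → Set
HasSuccessors T = ∀ {l} (t : Level T l) → Satisfiable (Tree.Successor T t)

CountablyBranching : Tree → Set
CountablyBranching T = ∀ {l} (t : Level T l) → Countable _≡_ (Tree.Successor T t)

Box : {d : ℕ} {X : Fin d → Set} → (∀ i → Pred (X i) 0ℓ) → Pred (∀ i → X i) 0ℓ
Box D x = ∀ i → x i ∈ D i

-- Subsets of ω are characteristic functions.

𝒫ω : Set
𝒫ω = ℕ → Bool

infix 4 _⊑_
_⊑_ : Rel 𝒫ω 0ℓ
X ⊑ Y = ∀ n → X n ≡ true → Y n ≡ true

infixr 7 _⊓_
_⊓_ : 𝒫ω → 𝒫ω → 𝒫ω
(X ⊓ Y) n = X n ∧ Y n

ω ∅ω : 𝒫ω
ω  = const true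
∅ω = const false

cantor : Topology 𝒫ω
cantor = record
  { Index = 𝒫ω × ℕ
  ; Basic = λ (X , n) Y → ∀ k → k < n → Y k ≡ X k
  }

record IsFilter (F : Pred 𝒫ω 0ℓ) : Set where
  field
    whole  : ω ∈ F
    upward : ∀ {X Y} → X ⊑ Y → X ∈ F → Y ∈ F
    meet   : ∀ {X Y} → X ∈ F → Y ∈ F → X ⊓ Y ∈ F
    proper : ¬ ∅ω ∈ F

IsFσFilter : Pred 𝒫ω 0ℓ → Set₁
IsFσFilter F = IsFilter F × Fσ cantor F

-- All supersets of finite intersections of members of G.
⟨_⟩ : Pred 𝒫ω 0ℓ → Pred 𝒫ω 0ℓ
⟨ G ⟩ X = ∃ λ (Ys : List 𝒫ω) → All G Ys × foldr _⊓_ ω Ys ⊑ X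

CountablyGenerated : Pred 𝒫ω 0ℓ → Set₁
CountablyGenerated F = ∃ λ (G : Pred 𝒫ω 0ℓ) → Countable _≗_ G × F ≐ ⟨ G ⟩

-- The set { n | f (b₁(n), …, b_d(n)) = a }.
colourSet : {A : Set} → DecidableEquality A → {d : ℕ} {T : Fin d → Tree} →
            (∀ l → (∀ i → Level (T i) l) → A) → (∀ i → Branch (T i)) → A → 𝒫ω
colourSet _≟_ f b a n = does (f n (λ i → node (b i) n) ≟ a)

{-# OPTIONS --safe #-}
-- Enumerate the nodes of each tree by ℕ, ordered by extension.  Inflationary maps of the coordinates
-- act on the colourings of d-tuples of nodes, and passing to the closure of an orbit keeps a colouring
-- constant on every cone where it was constant.  The Halpern–Läuchli theorem says that every orbit
-- closure contains a colouring which is constant on some cone.  In the step from d to d + 1, the case d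
-- allows one to assume that each f(·, w) is constant on densely many cones.  A cone and a colour either
-- can always be extended by a further w, which gives the conclusion, or are blocked for all w above some
-- node; if everything were blocked along a chain, the case d applied to a limit of the colourings f(·, w)
-- with w moving up the chain would give a contradiction.
--
-- Call a set of levels positive if it meets every member of F₀.  A limit of the colourings induced by f
-- along positive sets can be chosen constant on densely many cones; call it χ.  The branches in the sets
-- D_i grow in stages from one tip for each node.  Each stage moves one tuple of tips into a cone where χ
-- is constant, avoids one more nowhere dense set in each tree, and follows branches which realize χ on
-- enough levels to meet all members of the first few closed pieces of F₀, which is possible as these are
-- compact.  Then F is generated by F₀ and the sets of levels where the first n tuples of branches have
-- their limit colour.
module Submission where

open import Defs
open import Axiom.ExcludedMiddle using (ExcludedMiddle)
open import Data.Bool using (Bool; true; _∧_)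
open import Data.Bool.Properties using (∧-conicalˡ; ∧-conicalʳ)
open import Data.Fin using (Fin; zero; suc)
open import Data.Fin.Properties using (2↔Bool)
open import Data.List using (List; []; _∷_; length; foldr)
open import Data.List.Relation.Unary.All as All using (All; []; _∷_)
open import Data.Nat using (ℕ; zero; suc; _≤_; _<_; _⊔_; _+_; z≤n; s≤s; _≟_)
import Data.Nat.Properties as ℕ
open import Data.Product using (Σ; ∃; ∃₂; _×_; _,_; proj₁; proj₂)
open import Data.Sum using (inj₁; inj₂)
open import Data.Unit using (⊤; tt)
open import Data.Vec using (Vec; []; _∷_; lookup; tabulate; head; tail)
open import Data.Vec.Properties using (≡-dec; lookup∘tabulate; tabulate∘lookup; tabulate-cong)
open import Function using (_↔_; _⇔_; _∘_; id; mk⇔; module Inverse)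
open import Function.Properties.Inverse using (↔-sym)
open import Level using (0ℓ)
open import Relation.Binary using (Rel; IsPreorder; Reflexive; Transitive; _Respects_)
open import Relation.Binary.PropositionalEquality
  using (_≡_; _≢_; _≗_; refl; sym; trans; cong; cong₂; subst; subst₂; isEquivalence)
open import Relation.Nullary using (¬_; Dec; yes; no; does; contradiction)
open import Relation.Nullary.Decidable using (dec-true)
open import Relation.Unary using (Pred; _∈_; _⊆_; _≐_; _∩_; _∪_; Empty; ⋃)

-- Enumerations and compactness

record Enumeration (X : Set) : Set where
  field
    enum       : ℕ → X
    index      : X → ℕ
    enum-index : ∀ x → enum (index x) ≡ x

  index-injective : ∀ {x y} → index x ≡ index y → x ≡ y
  index-injective {x} {y} eq = trans (sym (enum-index x)) (trans (cong enum eq) (enum-index y))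

  at-index : (P : X → Set) {n : ℕ} → (∀ {j} → j < n → P (enum j)) → ∀ {x} → index x < n → P x
  at-index P below {x} index<n = subst P (enum-index x) (below index<n)

open Enumeration

ℕ-enumeration : Enumeration ℕ
ℕ-enumeration = record { enum = id ; index = id ; enum-index = λ _ → refl }

-- Cantor's walk: each antidiagonal is followed until the first coordinate is 0, then the next one
-- is entered at its other end.
diagonal-step : ℕ × ℕ → ℕ × ℕ
diagonal-step (zero  , b) = suc b , zero
diagonal-step (suc a , b) = a , suc b

diagonal : ℕ → ℕ × ℕ
diagonal zero    = 0 , 0
diagonal (suc n) = diagonal-step (diagonal n)

diagonal-reaches : ∀ s b a → a + b ≡ s → ∃ λ n → diagonal n ≡ (a , b)
diagonal-reaches zero zero zero _ = 0 , refl
diagonal-reaches (suc s) zero a a+0≡1+s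
  with refl ← trans (sym (ℕ.+-identityʳ a)) a+0≡1+s
  = let n , eq = diagonal-reaches s s 0 refl in suc n , cong diagonal-step eq
diagonal-reaches s (suc b) a a+1+b≡s =
  let n , eq = diagonal-reaches s b (suc a) (trans (sym (ℕ.+-suc a b)) a+1+b≡s)
  in suc n , cong diagonal-step eq

abstract
  ×-enumeration : ∀ {X Y} → Enumeration X → Enumeration Y → Enumeration (X × Y)
  ×-enumeration E F = record
    { enum       = λ n → let a , b = diagonal n in enum E a , enum F b
    ; index      = λ (x , y) → proj₁ (diagonal-reaches _ (index F y) (index E x) refl)
    ; enum-index = λ (x , y) →
        let _ , eq = diagonal-reaches _ (index F y) (index E x) refl
        in trans (cong (λ (a , b) → enum E a , enum F b) eq)
                 (cong₂ _,_ (enum-index E x) (enum-index F y))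
    }

  Vec-enumeration : ∀ {X} → Enumeration X → ∀ d → Enumeration (Vec X d)
  Vec-enumeration E zero = record
    { enum = λ _ → [] ; index = λ _ → 0 ; enum-index = λ { [] → refl } }
  Vec-enumeration {X} E (suc d) = record
    { enum       = λ n → let x , v = enum E×V n in x ∷ v
    ; index      = λ { (x ∷ v) → index E×V (x , v) }
    ; enum-index = λ { (x ∷ v) → cong (λ (x , v) → x ∷ v) (enum-index E×V (x , v)) }
    }
    where
    E×V : Enumeration (X × Vec X d)
    E×V = ×-enumeration E (Vec-enumeration E d)

ℕ×ℕ : Enumeration (ℕ × ℕ)
ℕ×ℕ = ×-enumeration ℕ-enumeration ℕ-enumeration

case-last : ∀ (P : ℕ → Set) {n} → (∀ {j} → j < n → P j) → P n → ∀ {j} → j < suc n → P j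
case-last P below last j<1+n with ℕ.m<1+n⇒m<n∨m≡n j<1+n
... | inj₁ j<n  = below j<n
... | inj₂ refl = last

-- Finite sets are handled as initial segments of an enumeration; this finds a segment containing
-- finitely many given points.
bounded : (h : ℕ → ℕ) (n : ℕ) → ∃ λ N → n ≤ N × (∀ {j} → j < n → h j < N)
bounded h zero    = 0 , z≤n , λ ()
bounded h (suc n) =
  let N , n≤N , <N = bounded h n in
  suc (N ⊔ h n) ,
  s≤s (ℕ.≤-trans n≤N (ℕ.m≤m⊔n N (h n))) ,
  λ {j} → case-last (λ j → h j < suc (N ⊔ h n))
    (λ j<n → s≤s (ℕ.≤-trans (ℕ.<⇒≤ (<N j<n)) (ℕ.m≤m⊔n N (h n))))
    (s≤s (ℕ.m≤n⊔m N (h n)))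

Fin-bounded : ∀ {d} (h : Fin d → ℕ) → ∃ λ N → ∀ i → h i ≤ N
Fin-bounded {zero}  h = 0 , λ ()
Fin-bounded {suc d} h =
  let N , ≤N = Fin-bounded (h ∘ suc) in
  h zero ⊔ N , λ { zero    → ℕ.m≤m⊔n (h zero) N
                 ; (suc i) → ℕ.≤-trans (≤N i) (ℕ.m≤n⊔m (h zero) N) }

antitone : (R : ℕ → Set) → (∀ {n} → R (suc n) → R n) → ∀ {m n} → m ≤ n → R n → R m
antitone R down {m} m≤n Rn with ℕ.m≤n⇒∃[o]m+o≡n m≤n
... | o , refl = descend o Rn
  where
  descend : ∀ o → R (m + o) → R m
  descend zero    = subst R (ℕ.+-identityʳ m)
  descend (suc o) = descend o ∘ down ∘ subst R (ℕ.+-suc m o)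

Finite : Set → Set
Finite B = ∃ λ k → B ↔ Fin k

Bool-finite : Finite Bool
Bool-finite = 2 , ↔-sym 2↔Bool

module _ {ℓ} {I : Set} {_≼_ : Rel I ℓ} (≼-refl : Reflexive _≼_) (≼-trans : Transitive _≼_) where

  Fin-cofinal : ∀ {k} {Q : Fin k → I → Set} →
                (∀ {a x y} → x ≼ y → Q a x → Q a y) →
                (∀ a x → ∃ λ y → x ≼ y × Q a y) →
                ∀ x → ∃ λ y → x ≼ y × ∀ a → Q a y
  Fin-cofinal {zero}  up dense x = x , ≼-refl , λ ()
  Fin-cofinal {suc k} up dense x =
    let y , x≼y , qy = dense zero x
        z , y≼z , qz = Fin-cofinal up (dense ∘ suc) y
    in z , ≼-trans x≼y y≼z , λ { zero → up y≼z qy ; (suc a) → qz a }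

  finite-cofinal : ∀ {B} {Q : B → I → Set} → Finite B →
                   (∀ {a x y} → x ≼ y → Q a x → Q a y) →
                   (∀ a x → ∃ λ y → x ≼ y × Q a y) →
                   ∀ x → ∃ λ y → x ≼ y × ∀ a → Q a y
  finite-cofinal {Q = Q} (_ , B↔Fin) up dense x =
    let y , x≼y , qy = Fin-cofinal up (dense ∘ from) x
    in y , x≼y , λ a → subst (λ a → Q a y) (strictlyInverseʳ a) (qy (to a))
    where open Inverse B↔Fin

module _ (em : ExcludedMiddle 0ℓ) where

  stable : {P : Set} → ¬ ¬ P → P
  stable {P} ¬¬p with em {P}
  ... | yes p = p
  ... | no ¬p = contradiction ¬p ¬¬p

  ¬∀⇒∃¬ : {X : Set} {P : X → Set} → ¬ (∀ x → P x) → ∃ λ x → ¬ P x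
  ¬∀⇒∃¬ ¬∀ = stable λ ¬∃ → ¬∀ λ x → stable λ ¬p → ¬∃ (x , ¬p)

  -- If every b failed somewhere, then, since failure persists to larger n, all the finitely many b
  -- would fail at a common n.
  pigeonhole : ∀ {B} → Finite B → {R : ℕ → B → Set} →
               (∀ {n b} → R (suc n) b → R n b) →
               (∀ n → ∃ (R n)) → ∃ λ b → ∀ n → R n b
  pigeonhole finite {R} down nonempty = stable λ none →
    let fails : ∀ b → ∃ λ n → ¬ R n b
        fails b = ¬∀⇒∃¬ λ all → none (b , all)
        up : ∀ {b m n} → m ≤ n → ¬ R m b → ¬ R n b
        up {b} m≤n ¬Rm Rn = ¬Rm (antitone (λ n → R n b) down m≤n Rn)
        n , _ , ¬R = finite-cofinal {_≼_ = _≤_} ℕ.≤-refl ℕ.≤-trans finite up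
                       (λ b m → let n , ¬Rn = fails b in
                         m ⊔ n , ℕ.m≤m⊔n m n , up (ℕ.m≤n⊔m m n) ¬Rn) 0
        b , Rb = nonempty n
    in ¬R b Rb

  module _ {X B : Set} (E : Enumeration X) (finite : Finite B)
           {R : ℕ → (X → B) → Set}
           (down : ∀ {n χ} → R (suc n) χ → R n χ)
           (local : ∀ {n χ χ′} → (∀ {j} → j < n → χ (enum E j) ≡ χ′ (enum E j)) → R n χ → R n χ′)
           (nonempty : ∀ n → ∃ (R n)) where

    private
      -- A partial colouring lists the colours of enum E 0, …, enum E (n - 1) in reverse.
      Extends : (X → B) → List B → Set
      Extends χ []      = ⊤
      Extends χ (b ∷ l) = χ (enum E (length l)) ≡ b × Extends χ l

      Extendible : List B → Set
      Extendible l = ∀ n → ∃ λ χ → R n χ × Extends χ l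

      extend : ∀ {l} → Extendible l → ∃ λ b → Extendible (b ∷ l)
      extend {l} ext = pigeonhole finite
        (λ (χ , r , e) → χ , down r , e)
        (λ n → let χ , r , e = ext n in _ , χ , r , refl , e)

      prefix : ℕ → ∃ Extendible
      prefix zero    = [] , λ n → let χ , r = nonempty n in χ , r , tt
      prefix (suc n) = let l , ext = prefix n
                           b , ext′ = extend ext in b ∷ l , ext′

      length-prefix : ∀ n → length (proj₁ (prefix n)) ≡ n
      length-prefix zero    = refl
      length-prefix (suc n) = cong suc (length-prefix n)

      colour : ℕ → B
      colour n = proj₁ (extend (proj₂ (prefix n)))

      agree : ∀ {χ} n → Extends χ (proj₁ (prefix n)) → ∀ {j} → j < n → χ (enum E j) ≡ colour j
      agree {χ} (suc n) (eq , e) = case-last (λ j → χ (enum E j) ≡ colour j) (agree n e)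
        (trans (cong (χ ∘ enum E) (sym (length-prefix n))) eq)

    -- König's lemma: by `pigeonhole`, a partial colouring that extends into every `R n` has a
    -- one-step extension of the same kind. The colours so chosen define the limit, and locality
    -- puts it into each `R n`.
    compactness : ∃ λ χ → ∀ n → R n χ
    compactness = limit , in-R
      where
      limit : X → B
      limit x = colour (index E x)

      in-R : ∀ n → R n limit
      in-R n =
        -- The enumeration may repeat, so the index of `enum E j` need not be j. The limit reads
        -- colours at these indices, and N exceeds them for all j < n.
        let N , n≤N , <N = bounded (index E ∘ enum E) n
            χ , r , e = proj₂ (prefix N) N
        in local (λ {j} j<n → trans (cong χ (sym (enum-index E (enum E j)))) (agree N e (<N j<n)))
                 (antitone (λ n → R n χ) down n≤N r)

-- The Halpern–Läuchli theorem

tuples : ∀ d → Enumeration (Vec ℕ d)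
tuples = Vec-enumeration ℕ-enumeration

tuples×ℕ : ∀ d → Enumeration (Vec ℕ d × ℕ)
tuples×ℕ d = ×-enumeration (tuples d) ℕ-enumeration

act : ∀ {d} → (Fin d → ℕ → ℕ) → Vec ℕ d → Vec ℕ d
act ρ v = tabulate λ i → ρ i (lookup v i)

lookup-act : ∀ {d} (ρ : Fin d → ℕ → ℕ) v i → lookup (act ρ v) i ≡ ρ i (lookup v i)
lookup-act ρ v = lookup∘tabulate λ i → ρ i (lookup v i)

act-id : ∀ {d} (v : Vec ℕ d) → act (λ _ → id) v ≡ v
act-id = tabulate∘lookup

act-∘ : ∀ {d} (σ ρ : Fin d → ℕ → ℕ) v → act σ (act ρ v) ≡ act (λ i → σ i ∘ ρ i) v
act-∘ σ ρ v = tabulate-cong λ i → cong (σ i) (lookup-act ρ v i)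

update : {X : Set} → (ℕ → X) → ℕ → X → ℕ → X
update h m x n with n ≟ m
... | yes _ = x
... | no  _ = h n

update-≡ : ∀ {X} (h : ℕ → X) m x → update h m x m ≡ x
update-≡ h m x with m ≟ m
... | yes _   = refl
... | no  m≢m = contradiction refl m≢m

update-elim : ∀ {X} (P : ℕ → X → Set) {h m x} → P m x → (∀ n → P n (h n)) → ∀ n → P n (update h m x n)
update-elim P {m = m} Px Ph n with n ≟ m
... | yes refl = Px
... | no  _    = Ph n

-- Cones of tuples and orbit closures of colourings

module Cones {d : ℕ} (O : Fin d → Rel ℕ 0ℓ) (isPreorder : ∀ i → IsPreorder _≡_ (O i)) where

  module O i = IsPreorder (isPreorder i)

  infix 4 _≤ᵛ_
  record _≤ᵛ_ (v u : Vec ℕ d) : Set where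
    constructor pointwise
    field at : ∀ i → O i (lookup v i) (lookup u i)

  open _≤ᵛ_ public

  ≤ᵛ-refl : ∀ {v} → v ≤ᵛ v
  ≤ᵛ-refl = pointwise λ i → O.refl i

  ≤ᵛ-trans : ∀ {u v w} → u ≤ᵛ v → v ≤ᵛ w → u ≤ᵛ w
  ≤ᵛ-trans u≤ᵛv v≤ᵛw = pointwise λ i → O.trans i (at u≤ᵛv i) (at v≤ᵛw i)

  infix 4 _≤ᵐ_
  _≤ᵐ_ : Rel (Fin d → ℕ → ℕ) 0ℓ
  σ ≤ᵐ ρ = ∀ i n → O i (σ i n) (ρ i n)

  ≤ᵐ-refl : ∀ {σ} → σ ≤ᵐ σ
  ≤ᵐ-refl i _ = O.refl i

  ≤ᵐ-trans : ∀ {σ ρ τ} → σ ≤ᵐ ρ → ρ ≤ᵐ τ → σ ≤ᵐ τ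
  ≤ᵐ-trans σ≤ρ ρ≤τ i n = O.trans i (σ≤ρ i n) (ρ≤τ i n)

  Inflationary : (Fin d → ℕ → ℕ) → Set
  Inflationary ρ = (λ _ → id) ≤ᵐ ρ

  ∘-inflationary : ∀ {σ ρ} → Inflationary σ → ρ ≤ᵐ (λ i → σ i ∘ ρ i)
  ∘-inflationary infl i n = infl i _

  act-mono : ∀ {σ ρ} → σ ≤ᵐ ρ → ∀ v → act σ v ≤ᵛ act ρ v
  act-mono {σ} {ρ} σ≤ρ v = pointwise λ i →
    subst₂ (O i) (sym (lookup-act σ v i)) (sym (lookup-act ρ v i)) (σ≤ρ i (lookup v i))

  ≤ᵛ-act : ∀ {ρ} → Inflationary ρ → ∀ v → v ≤ᵛ act ρ v
  ≤ᵛ-act {ρ} infl v = subst (_≤ᵛ act ρ v) (act-id v) (act-mono infl v)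

  -- Each `σ i` is changed only at the argument `lookup v i`, where it takes the larger value
  -- prescribed by t.
  raise : ∀ σ v {t} → act σ v ≤ᵛ t → ∃ λ τ → σ ≤ᵐ τ × t ≤ᵛ act τ v
  raise σ v {t} σv≤ᵛt = τ ,
    (λ i → update-elim (λ n x → O i (σ i n) x)
             (subst (λ x → O i x (lookup t i)) (lookup-act σ v i) (at σv≤ᵛt i)) (λ _ → O.refl i)) ,
    pointwise λ i → O.reflexive i
      (sym (trans (lookup-act τ v i) (update-≡ (σ i) (lookup v i) (lookup t i))))
    where
    τ : Fin d → ℕ → ℕ
    τ i = update (σ i) (lookup v i) (lookup t i)

  Constant : {B : Set} → (Vec ℕ d → B) → Vec ℕ d → Set
  Constant χ t = ∃ λ ε → ∀ {v} → t ≤ᵛ v → χ v ≡ ε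

  -- Finite sets of tuples are initial segments of the enumeration: ρ selects, above the coordinates
  -- of arbitrarily many tuples from the cone of t, nodes all of whose combinations have colour ε.
  Homogeneous : {B : Set} → (Vec ℕ d → B) → Vec ℕ d → B → Set
  Homogeneous χ t ε = ∀ n → ∃ λ ρ → Inflationary ρ ×
    (∀ {j} → j < n → t ≤ᵛ enum (tuples d) j → χ (act ρ (enum (tuples d) j)) ≡ ε)

  -- f ≼ f′ says that f is in the closure of the orbit of f′ under inflationary maps,
  -- and f ≼[ n ] f′ that the orbit meets the n-th basic neighbourhood of f.
  infix 4 _≼[_]_ _≼_
  record _≼[_]_ {B : Set} (f : Vec ℕ d → ℕ → B) (n : ℕ) (f′ : Vec ℕ d → ℕ → B) : Set where
    constructor orbit
    field
      move         : Fin d → ℕ → ℕ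
      inflationary : Inflationary move
      equal        : ∀ {j} → j < n → let v , w = enum (tuples×ℕ d) j in f v w ≡ f′ (act move v) w

  _≼_ : {B : Set} → Rel (Vec ℕ d → ℕ → B) 0ℓ
  f ≼ f′ = ∀ n → f ≼[ n ] f′

  module _ {B : Set} where

    ≼-at : {f f′ : Vec ℕ d → ℕ → B} → f ≼ f′ → ∀ n → ∃ λ ρ → Inflationary ρ ×
           (∀ {v w} → index (tuples×ℕ d) (v , w) < n → f v w ≡ f′ (act ρ v) w)
    ≼-at {f} {f′} f≼f′ n =
      let orbit ρ infl eq = f≼f′ n in
      ρ , infl , at-index (tuples×ℕ d) (λ (v , w) → f v w ≡ f′ (act ρ v) w) eq

    ≼-refl : {f : Vec ℕ d → ℕ → B} → f ≼ f
    ≼-refl {f} n = orbit (λ _ → id) ≤ᵐ-refl λ {j} _ →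
      let v , w = enum (tuples×ℕ d) j in cong (λ v → f v w) (sym (act-id v))

    ≼[]-mono : {f f′ : Vec ℕ d → ℕ → B} {m n : ℕ} → m ≤ n → f ≼[ n ] f′ → f ≼[ m ] f′
    ≼[]-mono m≤n (orbit ρ infl eq) = orbit ρ infl λ lt → eq (ℕ.≤-trans lt m≤n)

    ≼[]-trans : {f f′ f″ : Vec ℕ d → ℕ → B} {n : ℕ} → f ≼[ n ] f′ → f′ ≼ f″ → f ≼[ n ] f″
    ≼[]-trans {f″ = f″} {n} (orbit ρ ρ-infl eq) f′≼f″ =
      -- N covers the points to which ρ moves the first n points, since σ has to reproduce f′ at
      -- those.
      let N , _ , <N = bounded (λ j → let v , w = enum (tuples×ℕ d) j in
                                      index (tuples×ℕ d) (act ρ v , w)) n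
          σ , σ-infl , eq′ = ≼-at f′≼f″ N
      in orbit (λ i → σ i ∘ ρ i) (≤ᵐ-trans ρ-infl (∘-inflationary {ρ = ρ} σ-infl))
         λ {j} j<n → let v , w = enum (tuples×ℕ d) j in
           trans (eq j<n) (trans (eq′ (<N j<n)) (cong (λ v → f″ v w) (act-∘ σ ρ v)))

    -- Inflationary maps keep the cone of t inside itself, so every value of f on the cone is a
    -- value of f′ there.
    Constant-≼ : ∀ {f f′ : Vec ℕ d → ℕ → B} {w t} → f ≼ f′ →
                 Constant (λ v → f′ v w) t → Constant (λ v → f v w) t
    Constant-≼ {w = w} f≼f′ (ε , const) = ε , λ {v} t≤ᵛv →
      let ρ , infl , eq = ≼-at f≼f′ (suc (index (tuples×ℕ d) (v , w)))
      in trans (eq ℕ.≤-refl) (const (≤ᵛ-trans t≤ᵛv (≤ᵛ-act infl v)))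

  Tame : {B : Set} → (Vec ℕ d → ℕ → B) → Set
  Tame f = ∀ t₀ w → ∃ λ t → t₀ ≤ᵛ t × Constant (λ v → f v w) t

  HasHomogeneousCones : Set → Set
  HasHomogeneousCones B = ∀ (χ : Vec ℕ d → B) t₀ → ∃₂ λ t ε → t₀ ≤ᵛ t × Homogeneous χ t ε

-- Arbitrary preorders on ℕ let the induction drop the first coordinate, and later let the extension
-- order of nodes be transported to ℕ.
HalpernLäuchli : Set → ℕ → Set₁
HalpernLäuchli B d = (O : Fin d → Rel ℕ 0ℓ) (isPreorder : ∀ i → IsPreorder _≡_ (O i)) →
                     Cones.HasHomogeneousCones O isPreorder B

module _ (em : ExcludedMiddle 0ℓ) {B : Set} (finite : Finite B) where

  -- Colourings constant on densely many cones

  module Taming {d : ℕ} (O : Fin d → Rel ℕ 0ℓ) (isPreorder : ∀ i → IsPreorder _≡_ (O i))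
                (hl : HalpernLäuchli B d) where
    open Cones O isPreorder

    -- Homogeneity supplies translates of f whose slice at w is constant on ever larger finite parts
    -- of the cone of t; a limit given by compactness is constant on the whole cone.
    make-constant : ∀ (f : Vec ℕ d → ℕ → B) t₀ w →
                    ∃ λ f′ → f′ ≼ f × ∃ λ t → t₀ ≤ᵛ t × Constant (λ v → f′ v w) t
    make-constant f t₀ w =
      let t , ε , t₀≤ᵛt , homogeneous = hl O isPreorder (λ v → f v w) t₀

          R : ℕ → (Vec ℕ d × ℕ → B) → Set
          R n χ = ∃ λ ρ → Inflationary ρ ×
            (∀ {j} → j < n → let v , w = enum (tuples×ℕ d) j in χ (v , w) ≡ f (act ρ v) w) ×
            (∀ {j} → j < n → t ≤ᵛ enum (tuples d) j → f (act ρ (enum (tuples d) j)) w ≡ ε)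

          χ , r = compactness em (tuples×ℕ d) finite {R}
            (λ (ρ , infl , eq , hom) →
              ρ , infl , (λ lt → eq (ℕ.m<n⇒m<1+n lt)) , (λ lt → hom (ℕ.m<n⇒m<1+n lt)))
            (λ same (ρ , infl , eq , hom) →
              ρ , infl , (λ lt → trans (sym (same lt)) (eq lt)) , hom)
            (λ n → let ρ , infl , hom = homogeneous n in
              (λ (v , w) → f (act ρ v) w) , ρ , infl , (λ _ → refl) , hom)
      in (λ v w → χ (v , w)) ,
         (λ n → let ρ , infl , eq , _ = r n in orbit ρ infl eq) ,
         t , t₀≤ᵛt , ε , λ {v} t≤ᵛv →
           let j = index (tuples×ℕ d) (v , w)
               i = index (tuples d) v
               ρ , _ , eq , hom = r (suc (j ⊔ i))
           in trans (at-index (tuples×ℕ d) (λ (v , w) → χ (v , w) ≡ f (act ρ v) w) eq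
                       (s≤s (ℕ.m≤m⊔n j i)))
                    (at-index (tuples d) (λ v → t ≤ᵛ v → f (act ρ v) w ≡ ε) hom
                       (s≤s (ℕ.m≤n⊔m j i)) t≤ᵛv)

    -- The pairs `(t₀ , w)` are treated in the order of their enumeration. The limit lies in the
    -- orbit closure of every member of the sequence, so by `Constant-≼` it inherits all the
    -- constant cones.
    tame : ∀ (f : Vec ℕ d → ℕ → B) → ∃ λ f′ → f′ ≼ f × Tame f′
    tame f = limit , limit≼ 0 , λ t₀ w →
      let n = index (tuples×ℕ d) (t₀ , w)
          t , t₀≤ᵛt , const = subst
            (λ (t₀ , w) → ∃ λ t → t₀ ≤ᵛ t × Constant (λ v → sequence (suc n) v w) t)
            (enum-index (tuples×ℕ d) (t₀ , w))
            (proj₂ (proj₂ (step n (sequence n))))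
      in t , t₀≤ᵛt , Constant-≼ {f = limit} {w = w} (limit≼ (suc n)) const
      where
      step : ∀ n (g : Vec ℕ d → ℕ → B) → _
      step n g = let t₀ , w = enum (tuples×ℕ d) n in make-constant g t₀ w

      sequence : ℕ → Vec ℕ d → ℕ → B
      sequence zero    = f
      sequence (suc n) = proj₁ (step n (sequence n))

      sequence-≼ : ∀ m n → m ≤ n → sequence n ≼ sequence m
      sequence-≼ m n m≤n with ℕ.m≤n⇒∃[o]m+o≡n m≤n
      ... | o , refl = descend o
        where
        descend : ∀ o → sequence (m + o) ≼ sequence m
        descend zero    = subst (λ n → sequence n ≼ sequence m) (sym (ℕ.+-identityʳ m)) ≼-refl
        descend (suc o) = subst (λ n → sequence n ≼ sequence m) (sym (ℕ.+-suc m o))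
          (λ n → ≼[]-trans (proj₁ (proj₂ (step (m + o) (sequence (m + o)))) n) (descend o))

      limit′ : ∃ λ (χ : Vec ℕ d × ℕ → B) → ∀ n → (λ v w → χ (v , w)) ≼[ n ] sequence n
      limit′ = compactness em (tuples×ℕ d) finite
        (λ {n} r → ≼[]-mono (ℕ.n≤1+n n) (≼[]-trans r (sequence-≼ n (suc n) (ℕ.n≤1+n n))))
        (λ same (orbit ρ infl eq) → orbit ρ infl λ lt → trans (sym (same lt)) (eq lt))
        (λ n → (λ (v , w) → sequence n v w) , ≼-refl n)

      limit : Vec ℕ d → ℕ → B
      limit v w = proj₁ limit′ (v , w)

      limit≼ : ∀ m → limit ≼ sequence m
      limit≼ m n = ≼[]-mono (ℕ.m≤n⊔m m n)
        (≼[]-trans (proj₂ limit′ (m ⊔ n)) (sequence-≼ m (m ⊔ n) (ℕ.m≤m⊔n m n)))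

  -- The induction step from d to d + 1 trees

  module Step {d : ℕ} (O : Fin (suc d) → Rel ℕ 0ℓ) (isPreorder : ∀ i → IsPreorder _≡_ (O i))
              (hl : HalpernLäuchli B d) (f : Vec ℕ d → ℕ → B) where
    open Cones (O ∘ suc) (isPreorder ∘ suc) hiding (module O)
    module O₀ = IsPreorder (isPreorder zero)
    module Cones⁺ = Cones O isPreorder

    private
      O₀ : Rel ℕ 0ℓ
      O₀ = O zero

      e : ℕ → Vec ℕ d
      e = enum (tuples d)

    combined : Vec ℕ (suc d) → B
    combined (w ∷ v) = f v w

    -- Asking for the colour on whole cones, not just at the tips, makes the condition survive any
    -- further raising of σ.
    Coloured : (Fin d → ℕ → ℕ) → ℕ → B → Vec ℕ d → ℕ → Set
    Coloured σ w ε t n = ∀ {j} → j < n → t ≤ᵛ e j → ∀ {y} → act σ (e j) ≤ᵛ y → f y w ≡ ε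

    Coloured-mono : ∀ {σ τ w ε t n} → σ ≤ᵐ τ → Coloured σ w ε t n → Coloured τ w ε t n
    Coloured-mono σ≤τ col {j} j<n t≤ᵛe e≤ᵛy = col j<n t≤ᵛe (≤ᵛ-trans (act-mono σ≤τ (e j)) e≤ᵛy)

    Extendible : Vec ℕ d → B → ℕ → Set
    Extendible t ε c = ∀ n σ → Inflationary σ → ∀ g → O₀ c g →
                       ∃₂ λ w τ → O₀ g w × σ ≤ᵐ τ × Coloured τ w ε t n

    -- A failure of `Extendible` at a request g, with g in the place of c; it persists to all nodes
    -- above c.
    Blocked : Vec ℕ d → B → ℕ → Set
    Blocked t ε c = ∃₂ λ n σ → Inflationary σ ×
                    (∀ w τ → O₀ c w → σ ≤ᵐ τ → ¬ Coloured τ w ε t n)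

    -- The finitely many relevant heads g are served in turn. One map σ on the other coordinates is
    -- raised at each turn, and `Coloured-mono` keeps the earlier choices valid.
    Extendible⇒homogeneous : ∀ {t ε c} → Extendible t ε c →
                             Cones⁺.Homogeneous combined (c ∷ t) ε
    Extendible⇒homogeneous {t} {ε} {c} extendible n =
      ρ , infl , λ {j} j<n → coloured (enum (tuples (suc d)) j) (<N j<n) (<G j<n)
      where
      bound-tail = bounded (λ j → index (tuples d) (tail (enum (tuples (suc d)) j))) n
      bound-head = bounded (λ j → head (enum (tuples (suc d)) j)) n
      N = proj₁ bound-tail
      G = proj₁ bound-head
      <N = proj₂ (proj₂ bound-tail)
      <G = proj₂ (proj₂ bound-head)

      select : ∀ G → ∃ λ σ → Inflationary σ ×
               (∀ {g} → g < G → O₀ c g → ∃ λ w → O₀ g w × Coloured σ w ε t N)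
      select zero    = (λ _ → id) , ≤ᵐ-refl , λ ()
      select (suc G) with em {O₀ c G} | select G
      ... | no ¬c≤G | σ , infl , selected = σ , infl , λ g<1+G c≤g →
        case-last (λ g → O₀ c g → _) selected (λ c≤G → contradiction c≤G ¬c≤G) g<1+G c≤g
      ... | yes c≤G | σ , infl , selected =
        let w , τ , G≤w , σ≤τ , col = extendible N σ infl G c≤G
        in τ , ≤ᵐ-trans infl σ≤τ ,
           case-last (λ g → O₀ c g → ∃ λ w → O₀ g w × Coloured τ w ε t N)
             (λ g<G c≤g → let w , g≤w , col = selected g<G c≤g
                          in w , g≤w , Coloured-mono {w = w} σ≤τ col)
             (λ _ → w , G≤w , col)

      σ = proj₁ (select G)

      τ : ℕ → ℕ
      τ g with em {g < G × O₀ c g}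
      ... | yes (g<G , c≤g) = proj₁ (proj₂ (proj₂ (select G)) g<G c≤g)
      -- All other heads stay put, which keeps the map inflationary.
      ... | no  _           = g

      τ-infl : ∀ g → O₀ g (τ g)
      τ-infl g with em {g < G × O₀ c g}
      ... | yes (g<G , c≤g) = proj₁ (proj₂ (proj₂ (proj₂ (select G)) g<G c≤g))
      ... | no  _           = O₀.refl

      τ-coloured : ∀ {g} → g < G → O₀ c g → Coloured σ (τ g) ε t N
      τ-coloured {g} g<G c≤g with em {g < G × O₀ c g}
      ... | yes (g<G , c≤g) = proj₂ (proj₂ (proj₂ (proj₂ (select G)) g<G c≤g))
      ... | no  ¬p          = contradiction (g<G , c≤g) ¬p

      ρ : Fin (suc d) → ℕ → ℕ
      ρ zero    = τ
      ρ (suc i) = σ i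

      infl : Cones⁺.Inflationary ρ
      infl zero    = τ-infl
      infl (suc i) = proj₁ (proj₂ (select G)) i

      coloured : ∀ x → index (tuples d) (tail x) < N → head x < G → (c ∷ t) Cones⁺.≤ᵛ x →
                 combined (act ρ x) ≡ ε
      coloured (g ∷ v) v<N g<G c∷t≤ᵛx =
        at-index (tuples d) (λ v → t ≤ᵛ v → ∀ {y} → act σ v ≤ᵛ y → f y (τ g) ≡ ε)
          (τ-coloured g<G (Cones⁺.at c∷t≤ᵛx zero)) v<N
          (pointwise (Cones⁺.at c∷t≤ᵛx ∘ suc)) ≤ᵛ-refl

    module _ (tame : Tame f) where

      -- Tameness is applied to one tuple after another; later raises only shrink the cones already
      -- found.
      make-constant-on-tips : ∀ w n → ∃ λ σ → Inflationary σ ×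
                              (∀ {j} → j < n → Constant (λ v → f v w) (act σ (e j)))
      make-constant-on-tips w zero    = (λ _ → id) , ≤ᵐ-refl , λ ()
      make-constant-on-tips w (suc n) =
        let σ , infl , const = make-constant-on-tips w n
            t , σe≤ᵛt , ε , t-const = tame (act σ (e n)) w

            τ , σ≤τ , t≤ᵛτe = raise σ (e n) σe≤ᵛt
        in τ , ≤ᵐ-trans infl σ≤τ , case-last (λ j → Constant (λ v → f v w) (act τ (e j)))
             (λ {j} j<n → let ε , c = const j<n in
               ε , λ τe≤ᵛv → c (≤ᵛ-trans (act-mono σ≤τ (e j)) τe≤ᵛv))
             (ε , λ τe≤ᵛv → t-const (≤ᵛ-trans t≤ᵛτe τe≤ᵛv))

      find-extendible : ∀ c₀ t₀ → ∃₂ λ t c → ∃ λ ε → t₀ ≤ᵛ t × O₀ c₀ c × Extendible t ε c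
      find-extendible c₀ t₀ = stable em impossible
        where
        module _ (none : ¬ ∃₂ λ t c → ∃ λ ε → t₀ ≤ᵛ t × O₀ c₀ c × Extendible t ε c) where

          I : Set
          I = ∃ (O₀ c₀)

          _≤ᴵ_ : Rel I 0ℓ
          (c , _) ≤ᴵ (c′ , _) = O₀ c c′

          -- If nothing above c were blocked, every request above c could be granted, so t, ε and c
          -- would be extendible, against `none`.
          block : ∀ {t} → t₀ ≤ᵛ t → ∀ ε (c : I) → ∃ λ c′ → c ≤ᴵ c′ × Blocked t ε (proj₁ c′)
          block {t} t₀≤ᵛt ε (c , c₀≤c) = stable em λ unblocked →
            none (t , c , ε , t₀≤ᵛt , c₀≤c , λ n σ infl g c≤g → stable em λ stuck →
              unblocked ((g , O₀.trans c₀≤c c≤g) , c≤g , n , σ , infl , λ w τ g≤w σ≤τ col →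
                stuck (w , τ , g≤w , σ≤τ , col)))

          step : ∀ k (c : I) → ∃ λ c′ → c ≤ᴵ c′ × (t₀ ≤ᵛ e k → ∀ ε → Blocked (e k) ε (proj₁ c′))
          step k c with em {t₀ ≤ᵛ e k}
          ... | no  t₀≰ᵛe = c , O₀.refl , λ t₀≤ᵛe → contradiction t₀≤ᵛe t₀≰ᵛe
          ... | yes t₀≤ᵛe =
            let c′ , c≤c′ , blocked = finite-cofinal {_≼_ = _≤ᴵ_} O₀.refl O₀.trans finite
                  (λ x≤y (n , σ , infl , ¬col) → n , σ , infl , λ w τ y≤w → ¬col w τ (O₀.trans x≤y y≤w))
                  (block t₀≤ᵛe) c
            in c′ , c≤c′ , λ _ → blocked

          chain : ℕ → I
          chain zero    = c₀ , O₀.refl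
          chain (suc k) = proj₁ (step k (chain k))

          chain-mono : ∀ {m n} → m ≤ n → chain m ≤ᴵ chain n
          chain-mono {n = zero} z≤n = O₀.refl
          chain-mono {n = suc n} m≤1+n with ℕ.m≤n⇒m<n∨m≡n m≤1+n
          ... | inj₁ m<1+n = O₀.trans (chain-mono (ℕ.≤-pred m<1+n)) (proj₁ (proj₂ (step n (chain n))))
          ... | inj₂ refl  = O₀.refl

          -- Records the colours that a slice of f, at some w above the n-th node of the chain,
          -- takes on cones above the first n tuples. The case d is applied to a limit of such
          -- patterns.
          Pattern : ℕ → (Vec ℕ d → B) → Set
          Pattern n χ = ∃₂ λ w σ → O₀ (proj₁ (chain n)) w × Inflationary σ ×
                        (∀ {j} → j < n → ∀ {y} → act σ (e j) ≤ᵛ y → f y w ≡ χ (e j))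

          pattern-limit : ∃ λ χ → ∀ n → Pattern n χ
          pattern-limit = compactness em (tuples d) finite {Pattern}
            (λ {n} (w , σ , c≤w , infl , eq) →
              w , σ , O₀.trans (chain-mono (ℕ.n≤1+n n)) c≤w , infl , λ j<n → eq (ℕ.m<n⇒m<1+n j<n))
            (λ same (w , σ , c≤w , infl , eq) →
              w , σ , c≤w , infl , λ j<n e≤ᵛy → trans (eq j<n e≤ᵛy) (same j<n))
            (λ n → let w = proj₁ (chain n)
                       σ , infl , const = make-constant-on-tips w n
                   in (λ v → f (act σ v) w) , w , σ , O₀.refl , infl , λ j<n e≤ᵛy →
                      let ε , c = const j<n in trans (c e≤ᵛy) (sym (c ≤ᵛ-refl)))

          -- The limit pattern is homogeneous above some t by the theorem for d trees, so its colour
          -- there cannot have been blocked.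
          impossible : _
          impossible =
            let χ , pattern-χ = pattern-limit
                t , ε , t₀≤ᵛt , homogeneous = hl (O ∘ suc) (isPreorder ∘ suc) χ t₀
                k = index (tuples d) t
                n , σ* , σ*-infl , ¬col =
                  subst (λ t → t₀ ≤ᵛ t → ∀ ε → Blocked t ε (proj₁ (chain (suc k))))
                        (enum-index (tuples d) t) (proj₂ (proj₂ (step k (chain k)))) t₀≤ᵛt ε
                N , _ , <N = bounded (λ j → index (tuples d) (act σ* (e j))) n
                ρ , ρ-infl , hom = homogeneous N
                M , _ , <M = bounded (λ j → index (tuples d) (act ρ (act σ* (e j)))) n
                -- This stage puts w above the node where t and ε are blocked, and its pattern
                -- covers all the tuples moved by `σ*` and then ρ.
                w , σ , c≤w , σ-infl , eq = pattern-χ (suc k ⊔ M)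
                -- `σ*` comes first because blocking concerns the maps above it; ρ then moves the
                -- tuples to where χ is ε, and σ to cones where f realizes χ.
                τ = λ i → σ i ∘ ρ i ∘ σ* i
            in ¬col w τ (O₀.trans (chain-mono (ℕ.m≤m⊔n (suc k) M)) c≤w)
                 (≤ᵐ-trans (∘-inflationary {σ = ρ} {ρ = σ*} ρ-infl)
                           (∘-inflationary {σ = σ} {ρ = λ i → ρ i ∘ σ* i} σ-infl))
                 λ {j} j<n t≤ᵛe {y} τe≤ᵛy →
                   trans
                     (at-index (tuples d) (λ v → ∀ {y} → act σ v ≤ᵛ y → f y w ≡ χ v) eq
                       (ℕ.≤-trans (<M j<n) (ℕ.m≤n⊔m (suc k) M))
                       (subst (_≤ᵛ y)
                         (sym (trans (cong (act σ) (act-∘ ρ σ* (e j)))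
                                     (act-∘ σ (λ i → ρ i ∘ σ* i) (e j))))
                         τe≤ᵛy))
                     (at-index (tuples d) (λ v → t ≤ᵛ v → χ (act ρ v) ≡ ε) hom (<N j<n)
                       (≤ᵛ-trans t≤ᵛe (≤ᵛ-act σ*-infl (e j))))

  -- The slices of χ in the first coordinate are tamed, and `Step` finds a homogeneous cone for the
  -- tamed f. As f is in the orbit closure of the slices, a further map on the last d coordinates
  -- carries homogeneity back to χ.
  halpernLäuchli-suc : ∀ {d} → HalpernLäuchli B d → HalpernLäuchli B (suc d)
  halpernLäuchli-suc {d} hl O isPreorder χ (c₀ ∷ t₀) =
    c ∷ t , ε , Cones⁺.pointwise (λ { zero → c₀≤c ; (suc i) → at t₀≤ᵛt i }) , homogeneous
    where
    open Taming (O ∘ suc) (isPreorder ∘ suc) hl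
    open Cones (O ∘ suc) (isPreorder ∘ suc)

    tamed : ∃ λ f → f ≼ (λ v w → χ (w ∷ v)) × Tame f
    tamed = tame (λ v w → χ (w ∷ v))

    f : Vec ℕ d → ℕ → B
    f = proj₁ tamed

    open Step O isPreorder hl f
      using (module Cones⁺; Extendible; Extendible⇒homogeneous; find-extendible; combined)

    found : ∃₂ λ t c → ∃ λ ε → t₀ ≤ᵛ t × O zero c₀ c × Extendible t ε c
    found = find-extendible (proj₂ (proj₂ tamed)) c₀ t₀

    t = proj₁ found
    c = proj₁ (proj₂ found)
    ε = proj₁ (proj₂ (proj₂ found))
    t₀≤ᵛt = proj₁ (proj₂ (proj₂ (proj₂ found)))
    c₀≤c = proj₁ (proj₂ (proj₂ (proj₂ (proj₂ found))))

    compose : (Fin (suc d) → ℕ → ℕ) → (Fin d → ℕ → ℕ) → Fin (suc d) → ℕ → ℕ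
    compose ρ σ zero    = ρ zero
    compose ρ σ (suc i) = σ i ∘ ρ (suc i)

    compose-inflationary : ∀ {ρ σ} → Cones⁺.Inflationary ρ → Inflationary σ →
                           Cones⁺.Inflationary (compose ρ σ)
    compose-inflationary ρ-infl σ-infl zero    n = ρ-infl zero n
    compose-inflationary ρ-infl σ-infl (suc i) n =
      IsPreorder.trans (isPreorder (suc i)) (ρ-infl (suc i) n) (σ-infl i _)

    transfer : ∀ ρ σ x →
               f (tail (act ρ x)) (head (act ρ x)) ≡ χ (head (act ρ x) ∷ act σ (tail (act ρ x))) →
               combined (act ρ x) ≡ ε → χ (act (compose ρ σ) x) ≡ ε
    transfer ρ σ (w ∷ v) eq hom =
      trans (cong (λ v → χ (ρ zero w ∷ v)) (sym (act-∘ σ (ρ ∘ suc) v))) (trans (sym eq) hom)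

    homogeneous : Cones⁺.Homogeneous χ (c ∷ t) ε
    homogeneous n =
      let ρ , ρ-infl , hom = Extendible⇒homogeneous (proj₂ (proj₂ (proj₂ (proj₂ (proj₂ found))))) n
          N , _ , <N = bounded (λ j → let x = act ρ (enum (tuples (suc d)) j) in
                                      index (tuples×ℕ d) (tail x , head x)) n
          σ , σ-infl , eq = ≼-at (proj₁ (proj₂ tamed)) N
      in compose ρ σ , compose-inflationary ρ-infl σ-infl ,
         λ {j} j<n c∷t≤ᵛe → transfer ρ σ (enum (tuples (suc d)) j) (eq (<N j<n)) (hom j<n c∷t≤ᵛe)

  halpernLäuchli : ∀ d → HalpernLäuchli B d
  halpernLäuchli zero    O isPreorder χ [] =
    [] , χ [] , pointwise (λ ()) , λ n → (λ ()) , (λ ()) , λ _ _ → cong χ (unique _)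
    where
    open Cones O isPreorder
    unique : (v : Vec ℕ 0) → v ≡ []
    unique [] = refl
  halpernLäuchli (suc d) = halpernLäuchli-suc (halpernLäuchli d)

-- Nodes and branches

Node : Tree → Set
Node T = ∃ (Level T)

module _ {T : Tree} where
  open Tree T using (parent; root; root-unique)
  open Branch using (coherent)

  infix 4 _⊴_
  data _⊴_ : Node T → Node T → Set where
    here  : ∀ {u} → u ⊴ u
    there : ∀ {u l} {s : Level T (suc l)} → u ⊴ (l , parent s) → u ⊴ (suc l , s)

  ⊴-trans : ∀ {u v w} → u ⊴ v → v ⊴ w → u ⊴ w
  ⊴-trans u⊴v here        = u⊴v
  ⊴-trans u⊴v (there v⊴w) = there (⊴-trans u⊴v v⊴w)

  ⊴⇒≤ : ∀ {u v} → u ⊴ v → proj₁ u ≤ proj₁ v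
  ⊴⇒≤ here        = ℕ.≤-refl
  ⊴⇒≤ (there u⊴v) = ℕ.m≤n⇒m≤1+n (⊴⇒≤ u⊴v)

  ⊴-unique : ∀ {n} {t t′ : Level T n} {v} → (n , t) ⊴ v → (n , t′) ⊴ v → t ≡ t′
  ⊴-unique here      here      = refl
  ⊴-unique here      (there q) = contradiction (⊴⇒≤ q) ℕ.1+n≰n
  ⊴-unique (there p) here      = contradiction (⊴⇒≤ p) ℕ.1+n≰n
  ⊴-unique (there p) (there q) = ⊴-unique p q

  ancestor : ∀ {l} (s : Level T l) n → n ≤ l → ∃ λ t → (n , t) ⊴ (l , s)
  ancestor {l} s n n≤l with ℕ.m≤n⇒m<n∨m≡n n≤l
  ... | inj₂ refl = s , here
  ancestor {suc l} s n n≤l | inj₁ n<1+l =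
    let t , t⊴ = ancestor (parent s) n (ℕ.≤-pred n<1+l) in t , there t⊴

  Passes : Branch T → Node T → Set
  Passes b (l , t) = node b l ≡ t

  passes-⊴ : ∀ {b : Branch T} {u v} → u ⊴ v → Passes b v → Passes b u
  passes-⊴ here p = p
  passes-⊴ {b} (there {l = l} u⊴v) p =
    passes-⊴ {b} u⊴v (trans (sym (coherent b l)) (cong parent p))

  node-⊴ : ∀ (b : Branch T) {m n} → m ≤ n → (m , node b m) ⊴ (n , node b n)
  node-⊴ b {m} {n} m≤n with ℕ.m≤n⇒m<n∨m≡n m≤n
  ... | inj₂ refl = here
  node-⊴ b {m} {suc n} m≤n | inj₁ m<1+n =
    there (subst (λ t → (m , node b m) ⊴ (n , t)) (sym (coherent b n)) (node-⊴ b (ℕ.≤-pred m<1+n)))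

  passes⇒⊴ : ∀ {b : Branch T} {u v} → Passes b u → Passes b v → proj₁ u ≤ proj₁ v → u ⊴ v
  passes⇒⊴ {b} refl refl m≤n = node-⊴ b m≤n

  agree-below : ∀ {b c : Branch T} {m n} → m ≤ n → node b n ≡ node c n → node b m ≡ node c m
  agree-below {b} {c} m≤n eq = passes-⊴ {b} (node-⊴ c m≤n) eq

  -- The node at height n is the ancestor of `q n`, which exists by `high`; uniqueness of ancestors
  -- makes these nodes coherent.
  branch-along : (q : ℕ → Node T) → (∀ s → q s ⊴ q (suc s)) → (∀ s → s ≤ proj₁ (q s)) →
                 ∃ λ (b : Branch T) → ∀ s → Passes b (q s)
  branch-along q chain high = record { node = nodeAt ; coherent = coherentAt } , passes
    where
    ancestorAt : ∀ n → ∃ λ t → (n , t) ⊴ q n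
    ancestorAt n = ancestor (proj₂ (q n)) n (high n)

    nodeAt : ∀ n → Level T n
    nodeAt n = proj₁ (ancestorAt n)

    coherentAt : ∀ n → parent (nodeAt (suc n)) ≡ nodeAt n
    coherentAt n = ⊴-unique (⊴-trans (there here) (proj₂ (ancestorAt (suc n))))
                            (⊴-trans (proj₂ (ancestorAt n)) (chain n))

    chain-≤ : ∀ {m n} → m ≤ n → q m ⊴ q n
    chain-≤ {m} {n} m≤n with ℕ.m≤n⇒m<n∨m≡n m≤n
    ... | inj₂ refl = here
    chain-≤ {m} {suc n} m≤n | inj₁ m<1+n = ⊴-trans (chain-≤ (ℕ.≤-pred m<1+n)) (chain n)

    passes : ∀ s → nodeAt (proj₁ (q s)) ≡ proj₂ (q s)
    passes s = ⊴-unique (proj₂ (ancestorAt (proj₁ (q s)))) (chain-≤ (high s))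

  abstract
    branch-through : HasSuccessors T → ∀ u → ∃ λ (b : Branch T) → Passes b u
    branch-through succ u =
      let b , passes = branch-along q chain high in b , passes 0
      where
      q : ℕ → Node T
      q zero    = u
      q (suc s) = let l , t = q s in suc l , proj₁ (succ t)

      chain : ∀ s → q s ⊴ q (suc s)
      chain s = there (subst (λ t → q s ⊴ (_ , t)) (sym (proj₂ (succ (proj₂ (q s))))) here)

      high : ∀ s → s ≤ proj₁ (q s)
      high zero    = z≤n
      high (suc s) = s≤s (high s)

-- Enumerating the nodes and avoiding nowhere dense sets

module _ (em : ExcludedMiddle 0ℓ) {T : Tree}
         (succ : HasSuccessors T) (countable : CountablyBranching T) where
  open Tree T using (parent; root; root-unique)

  private
    child : ∀ {l} → ℕ → Level T l → Level T (suc l)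
    child c t with em {∃ λ s → parent s ≡ t × proj₁ (countable t) s ≡ c}
    ... | yes (s , _) = s
    -- A code that names no successor falls back on an arbitrary one, so that every word of codes
    -- decodes to a node.
    ... | no  _       = proj₁ (succ t)

    child-code : ∀ {l} (t : Level T l) {s} → parent s ≡ t → child (proj₁ (countable t) s) t ≡ s
    child-code t {s} s∈t
      with em {∃ λ s′ → parent s′ ≡ t × proj₁ (countable t) s′ ≡ proj₁ (countable t) s}
    ... | yes (s′ , s′∈t , eq) = proj₂ (countable t) s′∈t s∈t eq
    ... | no  ¬p               = contradiction (s , s∈t , refl) ¬p

    decode : ∀ {l} → Vec ℕ l → Level T l
    decode []       = root
    decode (c ∷ cs) = child c (decode cs)

    encode : ∀ {l} (t : Level T l) → ∃ λ cs → decode cs ≡ t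
    encode {zero}  t = [] , sym (root-unique t)
    encode {suc l} s =
      let cs , eq = encode (parent s)
      in proj₁ (countable (decode cs)) s ∷ cs , child-code (decode cs) (sym eq)

  abstract
    nodes : Enumeration (Node T)
    nodes = record
      { enum       = λ n → let l , m = enum ℕ×ℕ n in l , decode (enum (tuples l) m)
      ; index      = λ (l , t) → index ℕ×ℕ (l , index (tuples l) (proj₁ (encode t)))
      ; enum-index = λ (l , t) → trans
          (cong (λ (l , m) → l , decode (enum (tuples l) m)) (enum-index ℕ×ℕ _))
          (cong (l ,_) (trans (cong decode (enum-index (tuples l) _)) (proj₂ (encode t))))
      }

  -- Some branch b through u lies outside the closure of N, as the cone of u is open and nonempty. A
  -- basic neighbourhood of b misses N, and a node of b high enough lies above both u and the node
  -- of that neighbourhood.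
  avoid : ∀ {N} → NowhereDense (branches T) N → ∀ u →
          ∃ λ v → u ⊴ v × (∀ b → Passes b v → ¬ N b)
  avoid {N} nowhere u =
    let b , b∋u , b∉N̄ = escape
        v , ¬meets = ¬∀⇒∃¬ em b∉N̄
        b∋v = stable em λ ¬b∋v → ¬meets λ b∋v → contradiction b∋v ¬b∋v
        l = proj₁ u ⊔ proj₁ v
    in (l , node b l) ,
       passes⇒⊴ {b = b} b∋u refl (ℕ.m≤m⊔n (proj₁ u) (proj₁ v)) ,
       λ c c∋ Nc → ¬meets λ _ →
         c , passes-⊴ {b = c} (passes⇒⊴ {b = b} b∋v refl (ℕ.m≤n⊔m (proj₁ u) (proj₁ v))) c∋ , Nc
    where
    escape : ∃ λ b → Passes b u × ¬ Closure (branches T) N b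
    escape = stable em λ none →
      let b , b∋u = branch-through succ u
      in nowhere (λ b → Passes b u) (λ b b∋u → u , b∋u , id)
           (λ {b} b∋u → stable em λ b∉N̄ → none (b , b∋u , b∉N̄)) b b∋u

-- Positive sets and the construction of the branches

module _ (em : ExcludedMiddle 0ℓ) where

  closed-limit : ∀ {C} → Closed cantor C → ∀ {X} →
                 (∀ n → ∃ λ Y → Y ∈ C × (∀ {j} → j < n → Y j ≡ X j)) → X ∈ C
  closed-limit closed {X} approx = stable em λ X∉C →
    let (Z , n) , X∈ , ⊆∁C = closed X X∉C
        Y , Y∈C , Y≡X = approx n
    in ⊆∁C {Y} (λ k k<n → trans (Y≡X k<n) (X∈ k k<n)) Y∈C

  module Positivity {F₀ : Pred 𝒫ω 0ℓ} (isFilter : IsFilter F₀) where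
    open IsFilter isFilter

    Positive : Pred ℕ 0ℓ → Set
    Positive Z = ∀ {X} → X ∈ F₀ → ∃ λ m → X m ≡ true × Z m

    positive-mono : ∀ {Y Z} → (∀ {m} → Y m → Z m) → Positive Y → Positive Z
    positive-mono Y⊆Z pos X∈F₀ = let m , Xm , Ym = pos X∈F₀ in m , Xm , Y⊆Z Ym

    -- If each colour class missed a member of F₀, the intersection of these finitely many members
    -- would miss Z.
    positive-split : ∀ {A} → Finite A → ∀ {Z} → Positive Z → (c : ℕ → A) →
                     ∃ λ a → Positive (λ m → Z m × c m ≡ a)
    positive-split finite {Z} pos c = stable em λ none →
      let Misses : _ → 𝒫ω → Set
          Misses a X = ∀ {m} → X m ≡ true → Z m → c m ≢ a

          miss : ∀ a → ∃ λ X → X ∈ F₀ × Misses a X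
          miss a = stable em λ hit → none (a , λ {X} X∈F₀ → stable em λ disjoint →
            hit (X , X∈F₀ , λ {m} Xm Zm cm≡a → disjoint (m , Xm , Zm , cm≡a)))
          (X , X∈F₀) , _ , missed = finite-cofinal {I = ∃ F₀} {_≼_ = λ (X , _) (Y , _) → Y ⊑ X}
            (λ _ → id) (λ Y⊑X Z⊑Y m → Y⊑X m ∘ Z⊑Y m) {Q = λ a (X , _) → Misses a X} finite
            (λ Y⊑X missed {m} Ym → missed (Y⊑X m Ym))
            (λ a (X , X∈F₀) → let Y , Y∈F₀ , missed = miss a in
              (X ⊓ Y , meet X∈F₀ Y∈F₀) , (λ m → ∧-conicalˡ (X m) (Y m)) ,
              λ {m} X⊓Ym → missed (∧-conicalʳ (X m) (Y m) X⊓Ym))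
            (ω , whole)
          m , Xm , Zm = pos X∈F₀
      in missed (c m) Xm Zm refl

    -- Otherwise, for each n some member of C avoids Z below n. A limit of such members is in C,
    -- hence in F₀, and misses Z.
    positive-compact : ∀ {C} → Closed cantor C → C ⊆ F₀ → ∀ {Z} → Positive Z →
                       ∃ λ L → ∀ {X} → X ∈ C → ∃ λ m → m < L × X m ≡ true × Z m
    positive-compact {C} closed C⊆F₀ {Z} pos = stable em λ unbounded →
      let R : ℕ → 𝒫ω → Set
          -- Agreement below n with a member of C, in place of membership, makes the condition
          -- depend on finitely many values of X.
          R n X = ∃ λ Y → Y ∈ C × (∀ {j} → j < n → Y j ≡ X j) ×
                  (∀ {j} → j < n → X j ≡ true → ¬ Z j)

          X , r = compactness em ℕ-enumeration Bool-finite {R}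
            (λ (Y , Y∈C , Y≡X , avoids) →
              Y , Y∈C , (λ lt → Y≡X (ℕ.m<n⇒m<1+n lt)) , (λ lt → avoids (ℕ.m<n⇒m<1+n lt)))
            (λ same (Y , Y∈C , Y≡X , avoids) →
              Y , Y∈C , (λ lt → trans (Y≡X lt) (same lt)) , (λ lt Xj → avoids lt (trans (same lt) Xj)))
            (λ n → stable em λ none → unbounded (n , λ {X} X∈C → stable em λ missed →
              none (X , X , X∈C , (λ {_} _ → refl) , λ {j} lt Xj Zj → missed (j , lt , Xj , Zj))))

          X∈C = closed-limit closed λ n → let Y , Y∈C , Y≡X , _ = r n in Y , Y∈C , Y≡X
          m , Xm , Zm = pos (C⊆F₀ X∈C)
          _ , _ , _ , avoids = r (suc m)
      in avoids ℕ.≤-refl Xm Zm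

  -- The limit colouring and the growth of the branches

  module Construction
    {d : ℕ} {T : Fin d → Tree}
    (succ : ∀ i → HasSuccessors (T i)) (countable : ∀ i → CountablyBranching (T i))
    {A : Set} (finite : Finite A)
    (f : ∀ l → (∀ i → Level (T i) l) → A)
    (f-cong : ∀ l {s t} → (∀ i → s i ≡ t i) → f l s ≡ f l t)
    {F₀ : Pred 𝒫ω 0ℓ} (isFilter : IsFilter F₀)
    (C : ℕ → Pred 𝒫ω 0ℓ) (C-closed : ∀ k → Closed cantor (C k)) (C⊆F₀ : ∀ k → C k ⊆ F₀)
    (N : ∀ i → ℕ → Pred (Branch (T i)) 0ℓ)
    (N-nowhere : ∀ i k → NowhereDense (branches (T i)) (N i k))
    where

    open Positivity isFilter

    nodesOf : ∀ i → Enumeration (Node (T i))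
    nodesOf i = nodes em {T i} (succ i) (countable i)

    nodeOf : ∀ i → ℕ → Node (T i)
    nodeOf i = enum (nodesOf i)

    O : Fin d → Rel ℕ 0ℓ
    O i m n = _⊴_ {T i} (nodeOf i m) (nodeOf i n)

    O-isPreorder : ∀ i → IsPreorder _≡_ (O i)
    O-isPreorder i = record
      { isEquivalence = isEquivalence
      ; reflexive     = λ { refl → here {T = T i} }
      ; trans         = ⊴-trans {T = T i}
      }

    open Cones O O-isPreorder hiding (module O)

    E : Enumeration (Vec ℕ d)
    E = tuples d

    e : ℕ → Vec ℕ d
    e = enum E

    Through : (∀ i → ℕ → Branch (T i)) → Set
    Through b = ∀ i n → Passes (b i n) (nodeOf i n)

    colourAt : (∀ i → ℕ → Branch (T i)) → Vec ℕ d → ℕ → A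
    colourAt b v m = f m λ i → node (b i (lookup v i)) m

    Matches : (∀ i → ℕ → Branch (T i)) → (Vec ℕ d → A) → ℕ → Pred ℕ 0ℓ
    Matches b χ n m = ∀ {j} → j < n → colourAt b (e j) m ≡ χ (e j)

    -- The colouring χ of tuples of nodes is a limit of the colourings induced by f
    -- on branches through the nodes, along a positive set of levels.
    Realizable : (Vec ℕ d → A) → Set
    Realizable χ = ∀ n → ∃ λ b → Through b × Positive (Matches b χ n)

    abstract
      -- Branches `b₀` through all nodes are fixed. `positive-split` settles the colour of one more
      -- tuple on a positive set of levels, and compactness yields a single χ.
      some-realizable : ∃ Realizable
      some-realizable = let χ , pos = limit in χ , λ n → b₀ , b₀-through , pos n
        where
        b₀ : ∀ i → ℕ → Branch (T i)
        b₀ i n = proj₁ (branch-through (succ i) (nodeOf i n))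

        b₀-through : Through b₀
        b₀-through i n = proj₂ (branch-through (succ i) (nodeOf i n))

        R : ℕ → (Vec ℕ d → A) → Set
        R n χ = Positive (Matches b₀ χ n)

        recolour : (Vec ℕ d → A) → Vec ℕ d → A → Vec ℕ d → A
        recolour χ v a u with ≡-dec _≟_ u v
        ... | yes _ = a
        ... | no  _ = χ u

        recoloured : ∀ {χ v a u} {c : Vec ℕ d → A} → c u ≡ χ u → c v ≡ a → c u ≡ recolour χ v a u
        recoloured {v = v} {u = u} cu cv with ≡-dec _≟_ u v
        ... | yes refl = cv
        ... | no  _    = cu

        nonempty : ∀ n → ∃ (R n)
        -- With no tuple to match, positivity says that members of F₀ are nonempty, which is
        -- properness.
        nonempty zero    = (λ v → colourAt b₀ v 0) , λ X∈F₀ → stable em λ none →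
          proper (upward (λ m Xm → contradiction (m , Xm , λ ()) none) X∈F₀)
          where open IsFilter isFilter
        nonempty (suc n) =
          let χ , pos = nonempty n
              a , pos′ = positive-split finite pos (colourAt b₀ (e n))
          in recolour χ (e n) a , positive-mono (λ {m} (eq , eqₙ) {j} →
               case-last (λ j → colourAt b₀ (e j) m ≡ recolour χ (e n) a (e j))
                 (λ {j} j<n → recoloured {χ} {e n} {a} {e j} {λ v → colourAt b₀ v m} (eq j<n) eqₙ)
                 (recolour-≡ χ (e n) eqₙ)) pos′
          where
          recolour-≡ : ∀ χ v {a c} → c ≡ a → c ≡ recolour χ v a v
          recolour-≡ χ v c≡a with ≡-dec _≟_ v v
          ... | yes _   = c≡a
          ... | no  v≢v = contradiction refl v≢v

        limit : ∃ λ χ → ∀ n → R n χ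
        limit = compactness em E finite {R}
          (λ {n} {χ} → positive-mono {Y = Matches b₀ χ (suc n)} {Z = Matches b₀ χ n}
            λ eq {j} lt → eq (ℕ.m<n⇒m<1+n lt))
          (λ {n} {χ} {χ′} same → positive-mono {Y = Matches b₀ χ n} {Z = Matches b₀ χ′ n}
            λ eq {j} lt → trans (eq lt) (same lt))
          nonempty

    colourAt-cong : ∀ (b : ∀ i → ℕ → Branch (T i)) ρ v m →
                    colourAt (λ i → b i ∘ ρ i) v m ≡ colourAt b (act ρ v) m
    colourAt-cong b ρ v m = f-cong m λ i → cong (λ n → node (b i n) m) (sym (lookup-act ρ v i))

    -- The branches are reindexed by ρ: a branch through the node `ρ i m` also passes through the
    -- node m below it.
    realizable-≼ : ∀ {χ} {g : Vec ℕ d → ℕ → A} → g ≼ (λ v _ → χ v) →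
                   Realizable χ → Realizable (λ v → g v 0)
    realizable-≼ {χ} {g} g≼χ realizable n =
      let K , _ , <K = bounded (λ j → index (tuples×ℕ d) (e j , 0)) n
          ρ , infl , eq = ≼-at g≼χ K
          L , _ , <L = bounded (λ j → index E (act ρ (e j))) n
          b , through , pos = realizable L
      in (λ i → b i ∘ ρ i) ,
         (λ i m → passes-⊴ {b = b i (ρ i m)} (infl i m) (through i (ρ i m))) ,
         positive-mono {Y = Matches b χ L} (λ {m} realized {j} j<n →
           trans (colourAt-cong b ρ (e j) m)
             (trans (at-index E (λ v → colourAt b v m ≡ χ v) realized (<L j<n))
                    (sym (eq (<K j<n))))) pos

    abstract
      tame-realizable : ∃ λ χ → Realizable χ × (∀ t₀ → ∃ λ t → t₀ ≤ᵛ t × Constant χ t)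
      tame-realizable =
        let χ , realizable = some-realizable
            g , g≼χ , g-tame =
              -- χ enters as a colouring independent of its parameter; only the slice at 0 is kept.
              Taming.tame em finite O O-isPreorder (halpernLäuchli em finite d) (λ v _ → χ v)
        in (λ v → g v 0) , realizable-≼ g≼χ realizable , λ t₀ → g-tame t₀ 0

    χ : Vec ℕ d → A
    χ = proj₁ tame-realizable

    χ-realizable : Realizable χ
    χ-realizable = proj₁ (proj₂ tame-realizable)

    χ-tame : ∀ t₀ → ∃ λ t → t₀ ≤ᵛ t × Constant χ t
    χ-tame = proj₂ (proj₂ tame-realizable)

    -- `meets` speaks of arbitrary branches through the new tips, so that it applies to the limit
    -- branches, which are only defined after all stages.
    record Advance (s : ℕ) (τ τ′ : Fin d → ℕ → ℕ) : Set where
      field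
        mono     : τ ≤ᵐ τ′
        constant : Constant χ (act τ′ (e s))
        avoids   : ∀ i n b → Passes b (nodeOf i (τ′ i n)) → ¬ N i s b
        high     : ∀ i n → suc s ≤ proj₁ (nodeOf i (τ′ i n))
        meets    : ∀ {k} → k ≤ s → ∀ {X} → X ∈ C k → ∃ λ m → X m ≡ true ×
                   (∀ {j} → j < s → ∀ {ε} → (∀ {v} → act τ (e j) ≤ᵛ v → χ v ≡ ε) →
                    ∀ (b : ∀ i → Branch (T i)) →
                    (∀ i → Passes (b i) (nodeOf i (τ′ i (lookup (e j) i)))) →
                    f m (λ i → node (b i) m) ≡ ε)

    -- Three raises: `τ₁` enters a cone where χ is constant, `τ₂` avoids the s-th nowhere dense
    -- sets, and `τ₃` follows branches realizing χ.
    module Stage (s : ℕ) (τ : Fin d → ℕ → ℕ) where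

      raised = raise τ (e s) (proj₁ (proj₂ (χ-tame (act τ (e s)))))

      τ₁ : Fin d → ℕ → ℕ
      τ₁ = proj₁ raised

      t≤ᵛτ₁e = proj₂ (proj₂ raised)

      avoiding : ∀ i n → _
      avoiding i n = avoid em (succ i) (countable i) (N-nowhere i s) (nodeOf i n)

      τ₂ : Fin d → ℕ → ℕ
      τ₂ i n = index (nodesOf i) (proj₁ (avoiding i (τ₁ i n)))

      τ₁≤τ₂ : τ₁ ≤ᵐ τ₂
      τ₁≤τ₂ i n = subst (_⊴_ {T i} (nodeOf i (τ₁ i n))) (sym (enum-index (nodesOf i) _))
                    (proj₁ (proj₂ (avoiding i (τ₁ i n))))

      τ≤τ₂ : τ ≤ᵐ τ₂
      τ≤τ₂ = ≤ᵐ-trans (proj₁ (proj₂ raised)) τ₁≤τ₂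

      bound-K = bounded (λ j → index E (act τ₂ (e j))) s
      <K = proj₂ (proj₂ bound-K)
      realization = χ-realizable (proj₁ bound-K)

      b : ∀ i → ℕ → Branch (T i)
      b = proj₁ realization

      b-through : Through b
      b-through = proj₁ (proj₂ realization)

      hit : ∀ k → _
      hit k = positive-compact (C-closed k) (C⊆F₀ k) (proj₂ (proj₂ realization))

      bound-L = bounded (proj₁ ∘ hit) (suc s)
      L = proj₁ bound-L
      <L = proj₂ (proj₂ bound-L)

      -- From height L on, the tip fixes the branch at all levels used to hit the first pieces of
      -- F₀; the other terms keep it above `τ₂` and above height s.
      height : ∀ i → ℕ → ℕ
      height i n = L ⊔ (proj₁ (nodeOf i (τ₂ i n)) ⊔ suc s)

      τ₃ : Fin d → ℕ → ℕ
      τ₃ i n = index (nodesOf i) (height i n , node (b i (τ₂ i n)) (height i n))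

      τ₃-node : ∀ i n → nodeOf i (τ₃ i n) ≡ (height i n , node (b i (τ₂ i n)) (height i n))
      τ₃-node i n = enum-index (nodesOf i) _

      τ₂≤τ₃ : τ₂ ≤ᵐ τ₃
      τ₂≤τ₃ i n = subst (_⊴_ {T i} (nodeOf i (τ₂ i n))) (sym (τ₃-node i n))
        (passes⇒⊴ {b = b i (τ₂ i n)} (b-through i (τ₂ i n)) refl
          (ℕ.≤-trans (ℕ.m≤m⊔n _ (suc s)) (ℕ.m≤n⊔m L _)))

      advances : Advance s τ τ₃
      advances = record
        { mono     = ≤ᵐ-trans τ≤τ₂ τ₂≤τ₃
        ; constant = let _ , _ , ε , const = χ-tame (act τ (e s)) in
            ε , λ τ₃e≤ᵛv → const (≤ᵛ-trans t≤ᵛτ₁e (≤ᵛ-trans (act-mono (≤ᵐ-trans τ₁≤τ₂ τ₂≤τ₃) (e s)) τ₃e≤ᵛv))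
        ; avoids   = λ i n b b∋ → proj₂ (proj₂ (avoiding i (τ₁ i n))) b
            (passes-⊴ {b = b} (subst (λ u → _⊴_ {T i} u (nodeOf i (τ₃ i n))) (enum-index (nodesOf i) _) (τ₂≤τ₃ i n)) b∋)
        ; high     = λ i n → subst (suc s ≤_) (sym (cong proj₁ (τ₃-node i n)))
            (ℕ.≤-trans (ℕ.m≤n⊔m (proj₁ (nodeOf i (τ₂ i n))) (suc s)) (ℕ.m≤n⊔m L _))
        ; meets    = λ {k} k≤s {X} X∈C →
            let m , m<hit , Xm , realized = proj₂ (hit k) X∈C
                m≤L = ℕ.<⇒≤ (ℕ.<-trans m<hit (<L (s≤s k≤s)))
            in m , Xm , λ {j} j<s {ε} const b′ b′∋ →
               trans (f-cong m λ i → agree-below {b = b′ i} {c = b i (τ₂ i (lookup (e j) i))}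
                       (ℕ.≤-trans m≤L (ℕ.m≤m⊔n L (proj₁ (nodeOf i (τ₂ i (lookup (e j) i))) ⊔ suc s)))
                       (subst (Passes (b′ i)) (τ₃-node i (lookup (e j) i)) (b′∋ i)))
                 (trans (colourAt-cong b τ₂ (e j) m)
                   (trans (at-index E (λ v → colourAt b v m ≡ χ v) realized (<K j<s))
                          (const (act-mono τ≤τ₂ (e j)))))
        }

    abstract
      advance : ∀ s τ → ∃ (Advance s τ)
      advance s τ = Stage.τ₃ s τ , Stage.advances s τ

    -- Starting from the identity puts the n-th branch through the n-th node, which makes the set of
    -- branches dense.
    tips : ℕ → Fin d → ℕ → ℕ
    tips zero    _ = id
    tips (suc s)   = proj₁ (advance s (tips s))

    advanced : ∀ s → Advance s (tips s) (tips (suc s))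
    advanced s = proj₂ (advance s (tips s))

    module Advanced s = Advance (advanced s)

    tips-mono : ∀ {m n} → m ≤ n → tips m ≤ᵐ tips n
    tips-mono {m} {n} m≤n with ℕ.m≤n⇒m<n∨m≡n m≤n
    ... | inj₂ refl = ≤ᵐ-refl
    tips-mono {m} {suc n} m≤n | inj₁ m<1+n = ≤ᵐ-trans (tips-mono (ℕ.≤-pred m<1+n)) (Advanced.mono n)

    tips-high : ∀ s i n → s ≤ proj₁ (nodeOf i (tips s i n))
    tips-high zero    i n = z≤n
    tips-high (suc s) i n = Advanced.high s i n

    abstract
      limit-branch : ∀ i n → ∃ λ (b : Branch (T i)) → ∀ s → Passes b (nodeOf i (tips s i n))
      limit-branch i n = branch-along (λ s → nodeOf i (tips s i n))
                           (λ s → Advanced.mono s i n) (λ s → tips-high s i n)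

    β : ∀ i → ℕ → Branch (T i)
    β i n = proj₁ (limit-branch i n)

    β-passes : ∀ s i n → Passes (β i n) (nodeOf i (tips s i n))
    β-passes s i n = proj₂ (limit-branch i n) s

    β-avoids : ∀ i k n {b : Branch (T i)} → b ≈ᵇ β i n → ¬ N i k b
    β-avoids i k n {b} b≈β = Advanced.avoids k i n b (trans (b≈β _) (β-passes (suc k) i n))

    limitColour : Vec ℕ d → A
    limitColour v = proj₁ (Advanced.constant (index E v))

    settled : ∀ v {u} → act (tips (suc (index E v))) v ≤ᵛ u → χ u ≡ limitColour v
    settled v {u} τv≤ᵛu = proj₂ (Advanced.constant (index E v))
      (subst (λ v′ → act (tips (suc (index E v))) v′ ≤ᵛ u) (sym (enum-index E v)) τv≤ᵛu)

    -- `limitColour` uses the canonical index of the tuple, which may differ from j. The two cones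
    -- share the tips of a later stage, so their colours coincide.
    settled-at : ∀ j {u} → act (tips (suc j)) (e j) ≤ᵛ u → χ u ≡ limitColour (e j)
    settled-at j τe≤ᵛu =
      let k = index E (e j)
          ε , const = Advanced.constant j
      in trans (const τe≤ᵛu) (trans
           (sym (const (act-mono (tips-mono (s≤s (ℕ.m≤m⊔n j k))) (e j))))
           (settled (e j) (act-mono (tips-mono (s≤s (ℕ.m≤n⊔m j k))) (e j))))

    Agrees : ℕ → Pred ℕ 0ℓ
    Agrees n m = ∀ {j} → j < n → colourAt β (e j) m ≡ limitColour (e j)

    -- At stage `k ⊔ n` the piece of F₀ containing X is already treated and the first n tuples are
    -- already settled.
    agrees-positive : F₀ ⊆ ⋃ ℕ C → ∀ n → Positive (Agrees n)
    agrees-positive F₀⊆C n {X} X∈F₀ =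
      let k , X∈Ck = F₀⊆C {X} X∈F₀
          s = k ⊔ n
          m , Xm , met = Advanced.meets s (ℕ.m≤m⊔n k n) X∈Ck
      in m , Xm , λ {j} j<n →
         let j<s = ℕ.≤-trans j<n (ℕ.m≤n⊔m k n) in
         met j<s (λ τe≤ᵛv → settled-at j (≤ᵛ-trans (act-mono (tips-mono j<s) (e j)) τe≤ᵛv))
           (λ i → β i (lookup (e j) i)) (λ i → β-passes (suc s) i (lookup (e j) i))

    -- The neighbourhood is given by the tips at the stage that settles v. Later tips of branches in
    -- it lie in a cone where χ is constant.
    locally-constant :
      ∀ v → ∃ λ (u : ∀ i → Node (T i)) → (∀ i → Passes (β i (lookup v i)) (u i)) ×
      (∀ v′ → (∀ i → Passes (β i (lookup v′ i)) (u i)) → limitColour v′ ≡ limitColour v)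
    locally-constant v =
      (λ i → nodeOf i (tips s i (lookup v i))) , (λ i → β-passes s i (lookup v i)) , λ v′ β∋u →
        let K , ≤K = Fin-bounded λ i → proj₁ (nodeOf i (tips s i (lookup v i)))
            s′ = suc (index E v′) ⊔ K
            below : act (tips s) v ≤ᵛ act (tips s′) v′
            below = pointwise λ i →
              subst₂ (O i) (sym (lookup-act (tips s) v i)) (sym (lookup-act (tips s′) v′ i))
                (passes⇒⊴ {b = β i (lookup v′ i)} (β∋u i) (β-passes s′ i (lookup v′ i))
                  (ℕ.≤-trans (≤K i) (ℕ.≤-trans (ℕ.m≤n⊔m (suc (index E v′)) K)
                                               (tips-high s′ i (lookup v′ i)))))
        in trans (sym (settled v′ (act-mono (tips-mono (ℕ.m≤m⊔n (suc (index E v′)) K)) v′)))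
                 (settled v below)
      where
      s = suc (index E v)

-- The generated filter

does-true : {P : Set} (p? : Dec P) → does p? ≡ true → P
does-true (yes p) _ = p

∧-true : ∀ {x y} → x ≡ true → y ≡ true → x ∧ y ≡ true
∧-true refl refl = refl

⟨⟩⊆ : ∀ {F G} → IsFilter F → G ⊆ F → ⟨ G ⟩ ⊆ F
⟨⟩⊆ {F} {G} isFilter G⊆F {X} (Ys , Ys∈G , ⊑X) = upward ⊑X (foldr∈ Ys∈G)
  where
  open IsFilter isFilter
  foldr∈ : ∀ {Ys} → All G Ys → foldr _⊓_ ω Ys ∈ F
  foldr∈ []               = whole
  foldr∈ {Y ∷ _} (Y∈G ∷ Ys∈G) = meet (G⊆F {Y} Y∈G) (foldr∈ Ys∈G)

⊆⟨⟩ : ∀ {G} → G ⊆ ⟨ G ⟩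
⊆⟨⟩ {x = X} X∈G = X ∷ [] , X∈G ∷ [] , λ m → ∧-conicalˡ (X m) true

module _ (em : ExcludedMiddle 0ℓ) where

  limits⇒closed : ∀ {C} →
                  (∀ {X} → (∀ n → ∃ λ Y → Y ∈ C × (∀ {j} → j < n → Y j ≡ X j)) → X ∈ C) →
                  Closed cantor C
  limits⇒closed limits X X∉C = stable em λ none → X∉C (limits λ n → stable em λ isolated →
    none ((X , n) , (λ _ _ → refl) , λ {Y} Y≡X Y∈C → isolated (Y , Y∈C , λ {j} → Y≡X j)))

  module FilterExtension
    {F₀ : Pred 𝒫ω 0ℓ} (isFilter₀ : IsFilter F₀)
    (Y : ℕ → 𝒫ω) (Y-anti : ∀ {m n} → m ≤ n → Y n ⊑ Y m)
    (Y-positive : ∀ n {X} → X ∈ F₀ → ∃ λ m → X m ≡ true × Y n m ≡ true)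
    where

    private module F₀ = IsFilter isFilter₀

    -- The filter generated by F₀ and all `Y n`; one n suffices because the sets decrease.
    F : Pred 𝒫ω 0ℓ
    F X = ∃₂ λ Z n → Z ∈ F₀ × Z ⊓ Y n ⊑ X

    F-inhabited : ∀ {X} → X ∈ F → ∃ λ m → X m ≡ true
    F-inhabited (Z , n , Z∈F₀ , ⊑X) =
      let m , Zm , Ym = Y-positive n Z∈F₀ in m , ⊑X m (∧-true Zm Ym)

    isFilter : IsFilter F
    isFilter = record
      { whole  = ω , 0 , F₀.whole , λ _ _ → refl
      ; upward = λ X⊑X′ (Z , n , Z∈F₀ , ⊑X) → Z , n , Z∈F₀ , λ m → X⊑X′ m ∘ ⊑X m
      ; meet   = λ (Z , n , Z∈F₀ , ⊑X) (Z′ , n′ , Z′∈F₀ , ⊑X′) →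
          Z ⊓ Z′ , n ⊔ n′ , F₀.meet Z∈F₀ Z′∈F₀ , λ m ZZ′Ym →
          let ZZ′m = ∧-conicalˡ (Z m ∧ Z′ m) (Y (n ⊔ n′) m) ZZ′Ym
              Ym   = ∧-conicalʳ (Z m ∧ Z′ m) (Y (n ⊔ n′) m) ZZ′Ym
          in ∧-true
               (⊑X  m (∧-true (∧-conicalˡ (Z m) (Z′ m) ZZ′m) (Y-anti (ℕ.m≤m⊔n n n′) m Ym)))
               (⊑X′ m (∧-true (∧-conicalʳ (Z m) (Z′ m) ZZ′m) (Y-anti (ℕ.m≤n⊔m n n′) m Ym)))
      ; proper = λ ∅∈F → contradiction (proj₂ (F-inhabited ∅∈F)) λ ()
      }
    F₀⊆F : F₀ ⊆ F
    F₀⊆F {X} X∈F₀ = X , 0 , X∈F₀ , λ m → ∧-conicalˡ (X m) (Y 0 m)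

    Piece : Pred 𝒫ω 0ℓ → ℕ → Pred 𝒫ω 0ℓ
    Piece C n X = ∃ λ Z → Z ∈ C × Z ⊓ Y n ⊑ X

    -- Witnesses in C for approximations of X accumulate, by compactness, at some Z. It is in C by
    -- closedness, and its inclusion in X is checked level by level.
    piece-closed : ∀ {C} → Closed cantor C → ∀ n → Closed cantor (Piece C n)
    piece-closed {C} closed n = limits⇒closed {Piece C n} λ {X} approx →
      let R : ℕ → 𝒫ω → Set
          R k Z = (∃ λ Z′ → Z′ ∈ C × (∀ {j} → j < k → Z′ j ≡ Z j)) ×
                  (∀ {j} → j < k → (Z ⊓ Y n) j ≡ true → X j ≡ true)

          Z , r = compactness em ℕ-enumeration Bool-finite {R}
            (λ ((Z′ , Z′∈C , Z′≡Z) , ⊑X) →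
              (Z′ , Z′∈C , λ lt → Z′≡Z (ℕ.m<n⇒m<1+n lt)) , λ lt → ⊑X (ℕ.m<n⇒m<1+n lt))
            (λ same ((Z′ , Z′∈C , Z′≡Z) , ⊑X) →
              (Z′ , Z′∈C , λ lt → trans (Z′≡Z lt) (same lt)) ,
              λ {j} lt ZYj → ⊑X lt (trans (cong (_∧ Y n j) (same lt)) ZYj))
            (λ k → let X′ , (Z , Z∈C , ⊑X′) , X′≡X = approx k in
              Z , (Z , Z∈C , λ {_} _ → refl) , λ {j} lt ZYj → trans (sym (X′≡X lt)) (⊑X′ j ZYj))
      in Z , closed-limit em {C} closed {Z} (λ k → proj₁ (r k)) , λ m → proj₂ (r (suc m)) ℕ.≤-refl

    isFσ : Fσ cantor F₀ → Fσ cantor F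
    isFσ (C , C-closed , F₀⊆C , C⊆F₀) =
      (λ p → let k , n = enum ℕ×ℕ p in Piece (C k) n) ,
      (λ p → let k , n = enum ℕ×ℕ p in piece-closed (C-closed k) n) ,
      (λ {X} (Z , n , Z∈F₀ , ⊑X) →
        let k , Z∈C = F₀⊆C Z∈F₀ in
        index ℕ×ℕ (k , n) ,
        subst (λ (k , n) → Piece (C k) n X) (sym (enum-index ℕ×ℕ (k , n))) (Z , Z∈C , ⊑X)) ,
      (λ (p , Z , Z∈C , ⊑X) → Z , proj₂ (enum ℕ×ℕ p) , C⊆F₀ (_ , Z∈C) , ⊑X)
    S : Pred 𝒫ω 0ℓ
    S X = ∃ λ n → X ≗ Y n

    S-countable : Countable _≗_ S
    S-countable = code , λ {X} {X′} X∈S X′∈S eq m →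
      trans (code-spec X∈S m) (trans (cong (λ n → Y n m) eq) (sym (code-spec X′∈S m)))
      where
      code : 𝒫ω → ℕ
      code X with em {∃ λ n → X ≗ Y n}
      ... | yes (n , _) = n
      ... | no  _       = 0

      code-spec : ∀ {X} → X ∈ S → X ≗ Y (code X)
      code-spec {X} X∈S with em {∃ λ n → X ≗ Y n}
      ... | yes (_ , X≗Y) = X≗Y
      ... | no  X∉S       = contradiction X∈S X∉S

    S⊆F : S ⊆ F
    S⊆F (n , X≗Y) = ω , n , F₀.whole , λ m Ym → trans (X≗Y m) Ym

    generated : ∀ {G} → F₀ ⊆ ⟨ G ⟩ → G ⊆ F₀ → F ≐ ⟨ G ∪ S ⟩
    generated {G} F₀⊆G G⊆F₀ =
      (λ {X} (Z , n , Z∈F₀ , ⊑X) →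
        let Zs , Zs∈G , ⊑Z = F₀⊆G Z∈F₀ in
        Y n ∷ Zs , inj₂ (n , λ _ → refl) ∷ All.map inj₁ Zs∈G , λ m YZm →
          ⊑X m (∧-true (⊑Z m (∧-conicalʳ (Y n m) _ YZm)) (∧-conicalˡ (Y n m) _ YZm))) ,
      ⟨⟩⊆ {G = G ∪ S} isFilter λ { {X} (inj₁ X∈G) → F₀⊆F {X} (G⊆F₀ {X} X∈G)
                                 ; {X} (inj₂ X∈S) → S⊆F {X} X∈S }

    countablyGenerated : CountablyGenerated F₀ → CountablyGenerated F
    countablyGenerated (G , (code , injective) , F₀⊆G , G⊆F₀) =
      G ∪ S , (code′ , injective′) , generated F₀⊆G (λ {X} X∈G → G⊆F₀ (⊆⟨⟩ {G} {X} X∈G))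
      where
      -- The tags 0 and 1 keep the codes of G and S apart; a set in both is coded through G.
      code′ : 𝒫ω → ℕ
      code′ X with em {G X}
      ... | yes _ = index ℕ×ℕ (0 , code X)
      ... | no  _ = index ℕ×ℕ (1 , proj₁ S-countable X)

      injective′ : ∀ {X X′} → X ∈ G ∪ S → X′ ∈ G ∪ S → code′ X ≡ code′ X′ → X ≗ X′
      injective′ {X} {X′} X∈ X′∈ eq with em {G X} | em {G X′}
      ... | yes X∈G | yes X′∈G = injective X∈G X′∈G (cong proj₂ (index-injective ℕ×ℕ eq))
      ... | yes _   | no  _    with () ← cong proj₁ (index-injective ℕ×ℕ eq)
      ... | no  _   | yes _    with () ← cong proj₁ (index-injective ℕ×ℕ eq)
      ... | no X∉G  | no X′∉G  =
        proj₂ S-countable (in-S X∈ X∉G) (in-S X′∈ X′∉G) (cong proj₂ (index-injective ℕ×ℕ eq))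
        where
        in-S : ∀ {X} → X ∈ G ∪ S → ¬ G X → X ∈ S
        in-S (inj₁ X∈G) X∉G = contradiction X∈G X∉G
        in-S (inj₂ X∈S) _   = X∈S

-- The dense sets, the filter and the continuous limit colouring

theorem9 : (∀ {ℓ} → ExcludedMiddle ℓ) →
    (d : ℕ) → 1 ≤ d →
    (T : Fin d → Tree) →
    (∀ i → NoIsolatedBranches (T i)) →
    (∀ i → HasSuccessors (T i)) →
    (∀ i → CountablyBranching (T i)) →
    (A : Set) (k : ℕ) (A-finite : A ↔ Fin k) →
    (f : ∀ l → (∀ i → Level (T i) l) → A) →
    (∀ l {s t} → (∀ i → s i ≡ t i) → f l s ≡ f l t) →
    (F₀ : Pred 𝒫ω 0ℓ) → IsFσFilter F₀ →
    (M : ∀ i → Pred (Branch (T i)) 0ℓ) →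
    (∀ i → FirstCategory (branches (T i)) (M i)) →
    ∃₂ λ (D : ∀ i → Pred (Branch (T i)) 0ℓ) (F : Pred 𝒫ω 0ℓ) →
    (∀ i → D i Respects _≈ᵇ_) ×
    (∀ i → Dense (branches (T i)) (D i)) ×
    IsFσFilter F ×
    F₀ ⊆ F ×
    (∀ i → Empty (D i ∩ M i)) ×
    (∃ λ (g : Σ (∀ i → Branch (T i)) (Box D) → A) →
    (∀ b a → (g b ≡ a) ⇔ (colourSet (finite⇒≟ A-finite) f (proj₁ b) a ∈ F)) ×
    Continuous (subspace (product (λ i → branches (T i))) (Box D)) (discrete A) g) ×
    (CountablyGenerated F₀ → CountablyGenerated F) ×
    (∃ λ (S : Pred 𝒫ω 0ℓ) → Countable _≗_ S × F ≐ ⟨ F₀ ∪ S ⟩)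
theorem9 em d _ T _ succ countable A k A-finite f f-cong
         F₀ (isFilter₀ , C , C-closed , F₀⊆C , C⊆F₀) M M-meagre =
  D , F , D-respects , D-dense ,
  (isFilter , isFσ (C , C-closed , F₀⊆C , C⊆F₀)) , (λ {X} → F₀⊆F {X}) , D∩M-empty ,
  (g , g-characterised , g-continuous) , countablyGenerated ,
  S , S-countable , generated (λ {X} → ⊆⟨⟩ {F₀} {X}) id
  where
  open Construction em succ countable (k , A-finite) f f-cong isFilter₀
         C C-closed (λ k X∈C → C⊆F₀ (k , X∈C))
         (λ i → proj₁ (M-meagre i)) (λ i → proj₁ (proj₂ (M-meagre i)))

  Y : ℕ → 𝒫ω
  Y n m = does (em {P = Agrees n m})

  Y⇒Agrees : ∀ {n m} → Y n m ≡ true → Agrees n m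
  Y⇒Agrees = does-true em

  Agrees⇒Y : ∀ {n m} → Agrees n m → Y n m ≡ true
  Agrees⇒Y = dec-true em

  Y-anti : ∀ {m n} → m ≤ n → Y n ⊑ Y m
  Y-anti {m} {n} m≤n l Yl = Agrees⇒Y {m} {l} λ j<m → Y⇒Agrees {n} {l} Yl (ℕ.≤-trans j<m m≤n)

  Y-positive : ∀ n {X} → X ∈ F₀ → ∃ λ m → X m ≡ true × Y n m ≡ true
  Y-positive n X∈F₀ =
    let m , Xm , agrees = agrees-positive F₀⊆C n X∈F₀ in m , Xm , Agrees⇒Y {n} {m} agrees

  open FilterExtension em isFilter₀ Y Y-anti Y-positive

  D : ∀ i → Pred (Branch (T i)) 0ℓ
  D i b = ∃ λ n → b ≈ᵇ β i n

  D-respects : ∀ i → D i Respects _≈ᵇ_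
  D-respects i b≈c (n , b≈β) = n , λ l → trans (sym (b≈c l)) (b≈β l)

  D-dense : ∀ i → Dense (branches (T i)) (D i)
  D-dense i U U-open (b , b∈U) =
    let u , _ , u⊆U = U-open b b∈U
        n = index (nodesOf i) u
    in β i n , u⊆U (subst (Passes (β i n)) (enum-index (nodesOf i) u) (β-passes 0 i n)) , n , λ _ → refl

  D∩M-empty : ∀ i → Empty (D i ∩ M i)
  D∩M-empty i b ((n , b≈β) , b∈M) =
    let k , b∈N = proj₁ (proj₂ (proj₂ (M-meagre i))) b∈M in β-avoids i k n b≈β b∈N

  tuple : Σ (∀ i → Branch (T i)) (Box D) → Vec ℕ d
  tuple (_ , b∈D) = tabulate λ i → proj₁ (b∈D i)

  ≈β : ∀ b i → proj₁ b i ≈ᵇ β i (lookup (tuple b) i)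
  ≈β (b , b∈D) i = subst (λ n → b i ≈ᵇ β i n) (sym (lookup∘tabulate (proj₁ ∘ b∈D) i)) (proj₂ (b∈D i))

  -- The indices come from the membership proofs; by `g-characterised` the value depends only on the
  -- branches.
  g : Σ (∀ i → Branch (T i)) (Box D) → A
  g = limitColour ∘ tuple

  g-colourSet : ∀ b → colourSet (finite⇒≟ A-finite) f (proj₁ b) (g b) ∈ F
  g-colourSet b = ω , n , IsFilter.whole isFilter₀ , λ m Ym → dec-true (finite⇒≟ A-finite _ _)
    (trans (f-cong m λ i → ≈β b i m)
           (at-index E (λ v → colourAt β v m ≡ limitColour v) (Y⇒Agrees {n} {m} Ym) ℕ.≤-refl))
    where
    n = suc (index E (tuple b))

  g-characterised : ∀ b a → (g b ≡ a) ⇔ (colourSet (finite⇒≟ A-finite) f (proj₁ b) a ∈ F)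
  g-characterised b a = mk⇔ (λ { refl → g-colourSet b }) λ a∈F →
    -- Two colour sets in F share a level, and the tuple has only one colour there.
    let m , both = F-inhabited (IsFilter.meet isFilter (g-colourSet b) a∈F)
        colour   = colourSet (finite⇒≟ A-finite) f (proj₁ b)
    in trans (sym (does-true (finite⇒≟ A-finite _ _) (∧-conicalˡ (colour (g b) m) (colour a m) both)))
             (does-true (finite⇒≟ A-finite _ _) (∧-conicalʳ (colour (g b) m) (colour a m) both))

  g-continuous : Continuous (subspace (product (λ i → branches (T i))) (Box D)) (discrete A) g
  g-continuous V _ b gb∈V =
    let u , β∋u , constant = locally-constant (tuple b)
    in u , (λ i → trans (≈β b i _) (β∋u i)) , λ {b′} b′∋u →
       subst V (sym (constant (tuple b′) λ i → trans (sym (≈β b′ i _)) (b′∋u i))) gb∈V
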